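{- Let $Y$ be a single voltage cover of the complete bipartite graph $K_{n,n}$ by the cyclic group of order $d$, where $n,d\ge 3$. For any prime $p$ with $p\nmid n$, the Sylow $p$-subgroup $\mathcal J_p(Y)$ of $\mathcal J(Y)$ has the following (elementary divisor) decomposition: $$\mathcal J_p(Y)\cong(\mathbb Z/p^{2a}\mathbb Z)^{d-2}\oplus(\mathbb Z/p^{2a+b}\mathbb Z)^1,$$ where $p^a$ is the largest power of $p$ dividing $n-1$ and $p^b$ is the largest power of $p$ dividing $d$. In particular, $|\mathcal J_p(Y)|=p^{2a(d-1)+b}$, and the $p$-rank of $\mathcal J(Y)$ is $d-1$.
   Context: Graphs are simple. For a finite connected graph $Y$ with Laplacian $L=D-A$ (degree matrix minus adjacency matrix), the Jacobian $\mathcal J(Y)$ is the cokernel of a reduced Laplacian (the matrix obtained from $L$ by deleting the row and column of one vertex); it is a finite abelian group. Label the vertices of $K_{n,n}$ as $v_1,\dots,v_{2n}$, with $v_i$ adjacent to $v_j$ if and only if $i+j$ is odd. Let $G=\langle\tau\rangle$ be cyclic of order $d$. The single voltage assignment is $\alpha_{1,2}=\tau$, $\alpha_{2,1}=\tau^{ -1}$, and $\alpha_{i,j}=1$ (the identity of $G$) for all other ordered pairs $(i,j)$ with $v_i,v_j$ adjacent. The single voltage cover (derived graph) $Y$ has vertex set $\{v_{i,g}:1\le i\le 2n,\ g\in G\}$, with $v_{i,g}$ adjacent to $v_{j,h}$ if and only if $v_i,v_j$ are adjacent in $K_{n,n}$ and $h=g\alpha_{i,j}$. The $p$-rank of a finite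 abelian group is the minimal number of generators of its Sylow $p$-subgroup.
   Formalization: The claim that the p-rank is d-1 is stated only for primes p dividing n-1; when p does not divide n-1 the Sylow p-subgroup is Z/p^b, of rank at most 1 < d-1, so the printed claim is false there (e.g. n=d=3, p=5). -}

module Defs where

open import Level using (0ℓ)
open import Algebra.Bundles using (AbelianGroup)
import Algebra.Construct.DirectProduct as DirectProduct
import Algebra.Construct.Pointwise as Pointwise
open import Algebra.Morphism.Structures using (module GroupMorphisms)
import Algebra.Properties.AbelianGroup as AbelianGroupProperties
import Algebra.Properties.CommutativeMonoid.Mult as Mult
import Algebra.Properties.CommutativeSemigroup as CommutativeSemigroupProperties
open import Data.Bool using (if_then_else_)
open import Data.Fin using (Fin; toℕ; punchIn; _≟_)
open import Data.Fin.Properties using (*↔×)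
open import Data.Integer as ℤ using (ℤ; +_; 0ℤ; 1ℤ; -1ℤ)
import Data.Integer.Divisibility.Signed as ℤ∣
import Data.Integer.Properties as ℤ
open import Data.Integer.Tactic.RingSolver using (solve-∀)
open import Data.Nat as ℕ using (ℕ; zero; suc; pred; _^_; _≤_)
open import Data.Nat.Divisibility using (_∣_; _∤_; _∣?_; divides)
import Data.Nat.Properties as ℕ
open import Data.Product using (∃; _×_; _,_; proj₁; proj₂)
open import Data.Product.Function.NonDependent.Propositional using (_×-↔_)
open import Function using (_↔_; Inverse)
open import Function.Construct.Composition using (_↔-∘_)
open import Function.Construct.Identity using (↔-id)
open import Function.Construct.Symmetry using (↔-sym)
open import Relation.Binary using (Rel; Decidable; Symmetric; Irreflexive)
open import Relation.Binary.PropositionalEquality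
  using (_≡_; refl; sym; trans; cong; cong₂; subst; setoid; module ≡-Reasoning)
open import Relation.Nullary using (does; ¬?; _×-dec_)
open import Relation.Unary using (Pred; _∈_; _⊆_)

import Algebra.Properties.Semiring.Sum ℤ.+-*-semiring as ℤΣ

infix  4 _≅_
infixr 6 _⊕_
infixr 8 _^⊕_

Ab : Set₁
Ab = AbelianGroup 0ℓ 0ℓ

record Subgroup (A : Ab) : Set₁ where
  open AbelianGroup A
  field
    member    : Pred Carrier 0ℓ
    resp      : ∀ {x y} → x ≈ y → x ∈ member → y ∈ member
    ε-closed  : ε ∈ member
    ∙-closed  : ∀ {x y} → x ∈ member → y ∈ member → (x ∙ y) ∈ member
    ⁻¹-closed : ∀ {x} → x ∈ member → (x ⁻¹) ∈ member

subgroup : {A : Ab} → Subgroup A → Ab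
subgroup {A} S = record
  { Carrier = ∃ (Subgroup.member S)
  ; _≈_     = λ x y → proj₁ x ≈ proj₁ y
  ; _∙_     = λ x y → proj₁ x ∙ proj₁ y , ∙-closed (proj₂ x) (proj₂ y)
  ; ε       = ε , ε-closed
  ; _⁻¹     = λ x → proj₁ x ⁻¹ , ⁻¹-closed (proj₂ x)
  ; isAbelianGroup = record
    { isGroup = record
      { isMonoid = record
        { isSemigroup = record
          { isMagma = record
            { isEquivalence = record { refl = A.refl ; sym = A.sym ; trans = A.trans }
            ; ∙-cong = ∙-cong }
          ; assoc = λ x y z → assoc (proj₁ x) (proj₁ y) (proj₁ z) }
        ; identity = (λ x → identityˡ (proj₁ x)) , (λ x → identityʳ (proj₁ x)) }
      ; inverse = (λ x → inverseˡ (proj₁ x)) , (λ x → inverseʳ (proj₁ x))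
      ; ⁻¹-cong = ⁻¹-cong }
    ; comm = λ x y → comm (proj₁ x) (proj₁ y) }
  }
  where
  module A = AbelianGroup A
  open A hiding (refl; sym; trans)
  open Subgroup S

quotient : (A : Ab) → Subgroup A → Ab
quotient A S = record
  { Carrier = Carrier
  ; _≈_     = λ x y → member (x - y)
  ; _∙_     = _∙_
  ; ε       = ε
  ; _⁻¹     = _⁻¹
  ; isAbelianGroup = record
    { isGroup = record
      { isMonoid = record
        { isSemigroup = record
          { isMagma = record
            { isEquivalence = record
              { refl  = ≈⇒∈ A.refl
              ; sym   = λ {x} {y} p → resp (⁻¹-anti-homo‿- x y) (⁻¹-closed p)
              ; trans = λ {x} {y} {z} p q → resp (telescope x y z) (∙-closed p q) }
            ; ∙-cong = λ {x} {y} {u} {v} p q → resp (rearrange x y u v) (∙-closed p q) }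
          ; assoc = λ x y z → ≈⇒∈ (A.assoc x y z) }
        ; identity = (λ x → ≈⇒∈ (A.identityˡ x)) , (λ x → ≈⇒∈ (A.identityʳ x)) }
      ; inverse = (λ x → ≈⇒∈ (A.inverseˡ x)) , (λ x → ≈⇒∈ (A.inverseʳ x))
      ; ⁻¹-cong = λ {x} {y} p → resp (A.sym (⁻¹-∙-comm x (y ⁻¹))) (⁻¹-closed p) }
    ; comm = λ x y → ≈⇒∈ (A.comm x y) }
  }
  where
  module A = AbelianGroup A
  open A using (Carrier; _≈_; _∙_; ε; _⁻¹; _-_)
  open Subgroup S
  open AbelianGroupProperties A
  open CommutativeSemigroupProperties A.commutativeSemigroup using (interchange)
  open import Relation.Binary.Reasoning.Setoid A.setoid

  ≈⇒∈ : ∀ {x y} → x ≈ y → member (x - y)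
  ≈⇒∈ x≈y = resp (A.sym (x≈y⇒x∙y⁻¹≈ε x≈y)) ε-closed

  telescope : ∀ x y z → (x - y) ∙ (y - z) ≈ x - z
  telescope x y z = begin
    (x ∙ y ⁻¹) ∙ (y ∙ z ⁻¹)  ≈⟨ A.assoc (x ∙ y ⁻¹) y (z ⁻¹) ⟨
    (x ∙ y ⁻¹) ∙ y ∙ z ⁻¹    ≈⟨ A.∙-congʳ (//-rightDividesˡ y x) ⟩
    x ∙ z ⁻¹                 ∎

  rearrange : ∀ x y u v → (x - y) ∙ (u - v) ≈ (x ∙ u) - (y ∙ v)
  rearrange x y u v = begin
    (x ∙ y ⁻¹) ∙ (u ∙ v ⁻¹)  ≈⟨ interchange x (y ⁻¹) u (v ⁻¹) ⟩
    (x ∙ u) ∙ (y ⁻¹ ∙ v ⁻¹)  ≈⟨ A.∙-congˡ (⁻¹-∙-comm y v) ⟩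
    (x ∙ u) ∙ (y ∙ v) ⁻¹     ∎

_≅_ : Ab → Ab → Set
A ≅ B = ∃ (GroupMorphisms.IsGroupIsomorphism (AbelianGroup.rawGroup A) (AbelianGroup.rawGroup B))

_⊕_ : Ab → Ab → Ab
_⊕_ = DirectProduct.abelianGroup

_^⊕_ : Ab → ℕ → Ab
A ^⊕ k = Pointwise.abelianGroup (Fin k) A

ℤ/_ : ℕ → Ab
ℤ/ m = quotient ℤ.+-0-abelianGroup record
  { member    = + m ℤ∣.∣_
  ; resp      = subst (+ m ℤ∣.∣_)
  ; ε-closed  = ℤ∣.divides 0ℤ refl
  ; ∙-closed  = ℤ∣.∣m∣n⇒∣m+n
  ; ⁻¹-closed = ℤ∣.∣m⇒∣-m
  }

HasOrder : Ab → ℕ → Set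
HasOrder A N = Inverse (AbelianGroup.setoid A) (setoid (Fin N))

module _ (A : Ab) where
  open AbelianGroup A hiding (refl; sym; trans; setoid)

  data Generated {k} (g : Fin k → Carrier) : Pred Carrier 0ℓ where
    gen   : ∀ i → Generated g (g i)
    unit  : Generated g ε
    mult  : ∀ {x y} → Generated g x → Generated g y → Generated g (x ∙ y)
    inv   : ∀ {x} → Generated g x → Generated g (x ⁻¹)
    equal : ∀ {x y} → x ≈ y → Generated g x → Generated g y

  Generates : ∀ {k} → (Fin k → Carrier) → Set
  Generates g = ∀ x → Generated g x

  MinimalNumberOfGenerators : ℕ → Set
  MinimalNumberOfGenerators r =
    ∃ (Generates {r}) × (∀ {k} (g : Fin k → Carrier) → Generates g → r ≤ k)

module _ (p : ℕ) (A : Ab) where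
  open AbelianGroup A
  open Mult commutativeMonoid using () renaming (_×_ to _·_)

  -- For p prime: every element has order a power of p.
  IsPGroup : Subgroup A → Set
  IsPGroup S = ∀ {x} → x ∈ Subgroup.member S → ∃ λ k → (p ^ k) · x ≈ ε

record SylowSubgroup (p : ℕ) (A : Ab) : Set₁ where
  field
    carrier  : Subgroup A
    isPGroup : IsPGroup p A carrier
    maximal  : ∀ T → IsPGroup p A T → Subgroup.member carrier ⊆ Subgroup.member T →
               Subgroup.member T ⊆ Subgroup.member carrier

-- An abelian group has a unique Sylow p-subgroup: its elements of p-power order.
sylowSubgroup : ∀ p A → SylowSubgroup p A
sylowSubgroup p A = record
  { carrier = record
    { member    = λ x → ∃ λ k → (p ^ k) · x ≈ ε
    ; resp      = λ x≈y (k , e) → k , A.trans (×-congʳ (p ^ k) (A.sym x≈y)) e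
    ; ε-closed  = 0 , identityʳ ε
    ; ∙-closed  = λ {x} {y} (k , e) (l , f) → k ℕ.+ l , product x y k l e f
    ; ⁻¹-closed = λ {x} (k , e) → k , annihilate⁻¹ (p ^ k) x e
    }
  ; isPGroup = λ x∈ → x∈
  ; maximal  = λ T T-p _ → T-p
  }
  where
  module A = AbelianGroup A
  open A hiding (refl; sym; trans; setoid)
  open Mult commutativeMonoid using (×-congʳ; ×-congˡ; ×-assocˡ; ×-distrib-+) renaming (_×_ to _·_)
  open import Relation.Binary.Reasoning.Setoid A.setoid

  zeroʳ : ∀ n → n · ε ≈ ε
  zeroʳ zero    = A.refl
  zeroʳ (suc n) = A.trans (identityˡ (n · ε)) (zeroʳ n)

  annihilate : ∀ m n x → n · x ≈ ε → (m ℕ.* n) · x ≈ ε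
  annihilate m n x e = A.trans (A.sym (×-assocˡ x m n)) (A.trans (×-congʳ m e) (zeroʳ m))

  product : ∀ x y k l → (p ^ k) · x ≈ ε → (p ^ l) · y ≈ ε → (p ^ (k ℕ.+ l)) · (x ∙ y) ≈ ε
  product x y k l e f = begin
    (p ^ (k ℕ.+ l)) · (x ∙ y)                        ≈⟨ ×-distrib-+ x y (p ^ (k ℕ.+ l)) ⟩
    (p ^ (k ℕ.+ l)) · x ∙ (p ^ (k ℕ.+ l)) · y        ≈⟨ ∙-cong
      (×-congˡ (trans (ℕ.^-distribˡ-+-* p k l) (ℕ.*-comm (p ^ k) (p ^ l))))
      (×-congˡ (ℕ.^-distribˡ-+-* p k l)) ⟩
    (p ^ l ℕ.* p ^ k) · x ∙ (p ^ k ℕ.* p ^ l) · y    ≈⟨ ∙-cong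
      (annihilate (p ^ l) (p ^ k) x e) (annihilate (p ^ k) (p ^ l) y f) ⟩
    ε ∙ ε                                            ≈⟨ identityˡ ε ⟩
    ε                                                ∎

  annihilate⁻¹ : ∀ n x → n · x ≈ ε → n · (x ⁻¹) ≈ ε
  annihilate⁻¹ n x e = begin
    n · (x ⁻¹)          ≈⟨ identityˡ _ ⟨
    ε ∙ n · (x ⁻¹)      ≈⟨ ∙-congʳ e ⟨
    n · x ∙ n · (x ⁻¹)  ≈⟨ ×-distrib-+ x (x ⁻¹) n ⟨
    n · (x ∙ x ⁻¹)      ≈⟨ ×-congʳ n (inverseʳ x) ⟩
    n · ε               ≈⟨ zeroʳ n ⟩
    ε                   ∎

Sylow : ℕ → Ab → Ab
Sylow p A = subgroup (SylowSubgroup.carrier (sylowSubgroup p A))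

PRank : ℕ → Ab → ℕ → Set
PRank p A = MinimalNumberOfGenerators (Sylow p A)

Matrix : ℕ → Set
Matrix m = Fin m → Fin m → ℤ

_*ᵥ_ : ∀ {m} → Matrix m → (Fin m → ℤ) → (Fin m → ℤ)
(M *ᵥ z) i = ℤΣ.sum (λ j → M i j ℤ.* z j)

cokernel : ∀ {m} → Matrix m → Ab
cokernel {m} M = quotient (ℤ.+-0-abelianGroup ^⊕ m) record
  { member    = λ x → ∃ λ z → ∀ i → x i ≡ (M *ᵥ z) i
  ; resp      = λ x≈y (z , e) → z , λ i → trans (sym (x≈y i)) (e i)
  ; ε-closed  = (λ _ → 0ℤ) , λ i → sym (null i)
  ; ∙-closed  = λ (z , e) (w , f) → (λ j → z j ℤ.+ w j) ,
                  λ i → trans (cong₂ ℤ._+_ (e i) (f i)) (sym (add z w i))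
  ; ⁻¹-closed = λ (z , e) → (λ j → ℤ.- z j) , λ i → trans (cong ℤ.-_ (e i)) (negate z i)
  }
  where
  open ≡-Reasoning

  null : ∀ i → (M *ᵥ (λ _ → 0ℤ)) i ≡ 0ℤ
  null i = trans (ℤΣ.sum-cong-≗ (λ j → ℤ.*-zeroʳ (M i j))) (ℤΣ.sum-replicate-zero m)

  add : ∀ z w i → (M *ᵥ (λ j → z j ℤ.+ w j)) i ≡ (M *ᵥ z) i ℤ.+ (M *ᵥ w) i
  add z w i = trans
    (ℤΣ.sum-cong-≗ (λ j → ℤ.*-distribˡ-+ (M i j) (z j) (w j)))
    (ℤΣ.∑-distrib-+ (λ j → M i j ℤ.* z j) (λ j → M i j ℤ.* w j))

  negate : ∀ z i → ℤ.- (M *ᵥ z) i ≡ (M *ᵥ (λ j → ℤ.- z j)) i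
  negate z i = begin
    ℤ.- (M *ᵥ z) i                               ≡⟨ ℤ.-1*i≡-i ((M *ᵥ z) i) ⟨
    -1ℤ ℤ.* (M *ᵥ z) i                           ≡⟨ ℤΣ.*-distribˡ-sum -1ℤ (λ j → M i j ℤ.* z j) ⟩
    ℤΣ.sum (λ j → -1ℤ ℤ.* (M i j ℤ.* z j))       ≡⟨ ℤΣ.sum-cong-≗ (λ j →
      trans (ℤ.-1*i≡-i (M i j ℤ.* z j)) (ℤ.neg-distribʳ-* (M i j) (z j))) ⟩
    (M *ᵥ (λ j → ℤ.- z j)) i                     ∎

deleteRowCol : ∀ {m} → Fin m → Matrix m → Matrix (pred m)
deleteRowCol {suc m} v M i j = M (punchIn v i) (punchIn v j)

record Graph : Set₁ where
  field
    Vertex   : Set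
    order    : ℕ
    vertices : Vertex ↔ Fin order
    _~_      : Rel Vertex 0ℓ
    _~?_     : Decidable _~_
    ~-sym    : Symmetric _~_
    ~-irrefl : Irreflexive _≡_ _~_

  index : Vertex → Fin order
  index = Inverse.to vertices

  vertex : Fin order → Vertex
  vertex = Inverse.from vertices

  adjacency : Matrix order
  adjacency i j = if does (vertex i ~? vertex j) then 1ℤ else 0ℤ

  degree : Matrix order
  degree i j = if does (i ≟ j) then ℤΣ.sum (adjacency i) else 0ℤ

  laplacian : Matrix order
  laplacian i j = degree i j ℤ.- adjacency i j

  -- Up to isomorphism the group does not depend on the deleted vertex when the graph is connected.
  jacobian : Vertex → Ab
  jacobian v = cokernel (deleteRowCol (index v) laplacian)

-- The vertex v_i is represented by i - 1.
label : ∀ {n} → Fin n → ℕ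
label i = suc (toℕ i)

completeBipartite : ℕ → Graph
completeBipartite n = record
  { Vertex   = Fin (2 ℕ.* n)
  ; order    = 2 ℕ.* n
  ; vertices = ↔-id _
  ; _~_      = λ i j → 2 ∤ label i ℕ.+ label j
  ; _~?_     = λ i j → ¬? (2 ∣? (label i ℕ.+ label j))
  ; ~-sym    = λ {i} {j} odd even → odd (subst (2 ∣_) (ℕ.+-comm (label j) (label i)) even)
  ; ~-irrefl = λ { {i} refl odd → odd (divides (label i) (double (label i))) }
  }
  where
  double : ∀ m → m ℕ.+ m ≡ m ℕ.* 2
  double m = trans (cong (m ℕ.+_) (sym (ℕ.+-identityʳ m))) (ℕ.*-comm 2 m)

-- The derived graph for voltages in the cyclic group ⟨τ⟩ of order d, with ⟨τ⟩ written additively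
-- as ℤ/d: the voltage τ^e is given by e, and k : Fin d stands for the element τ^k.
module _ (X : Graph) (d : ℕ) where
  open Graph X

  derivedGraph : (α : Vertex → Vertex → ℤ) → (∀ i j → α j i ≡ ℤ.- α i j) → Graph
  derivedGraph α α-inverse = record
    { Vertex   = Vertex × Fin d
    ; order    = order ℕ.* d
    ; vertices = ↔-sym *↔× ↔-∘ (vertices ×-↔ ↔-id (Fin d))
    ; _~_      = λ (i , g) (j , h) → i ~ j × + toℕ h ≈ + toℕ g ℤ.+ α i j
    ; _~?_     = λ (i , g) (j , h) → (i ~? j) ×-dec (+ d ℤ∣.∣? (+ toℕ h ℤ.- (+ toℕ g ℤ.+ α i j)))
    ; ~-sym    = λ { {i , g} {j , h} (i~j , e) → ~-sym i~j , flip i j (+ toℕ g) (+ toℕ h) e }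
    ; ~-irrefl = λ { refl (i~i , _) → ~-irrefl refl i~i }
    }
    where
    open AbelianGroup (ℤ/ d) using (_≈_)

    reverse : ∀ a g h → ℤ.- (h ℤ.- (g ℤ.+ a)) ≡ g ℤ.- (h ℤ.+ ℤ.- a)
    reverse = solve-∀

    flip : ∀ i j g h → h ≈ g ℤ.+ α i j → g ≈ h ℤ.+ α j i
    flip i j g h e rewrite α-inverse i j =
      subst (+ d ℤ∣.∣_) (reverse (α i j) g h) (ℤ∣.∣m⇒∣-m e)

singleVoltage : ℕ → ℕ → ℤ
singleVoltage 1 2 = 1ℤ
singleVoltage 2 1 = -1ℤ
singleVoltage _ _ = 0ℤ

singleVoltage-inverse : ∀ i j → singleVoltage j i ≡ ℤ.- singleVoltage i j
singleVoltage-inverse 0 0 = refl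
singleVoltage-inverse 0 1 = refl
singleVoltage-inverse 0 2 = refl
singleVoltage-inverse 0 (suc (suc (suc _))) = refl
singleVoltage-inverse 1 0 = refl
singleVoltage-inverse 1 1 = refl
singleVoltage-inverse 1 2 = refl
singleVoltage-inverse 1 (suc (suc (suc _))) = refl
singleVoltage-inverse 2 0 = refl
singleVoltage-inverse 2 1 = refl
singleVoltage-inverse 2 2 = refl
singleVoltage-inverse 2 (suc (suc (suc _))) = refl
singleVoltage-inverse (suc (suc (suc _))) 0 = refl
singleVoltage-inverse (suc (suc (suc _))) 1 = refl
singleVoltage-inverse (suc (suc (suc _))) 2 = refl
singleVoltage-inverse (suc (suc (suc _))) (suc (suc (suc _))) = refl

singleVoltageCover : ℕ → ℕ → Graph
singleVoltageCover n d = derivedGraph (completeBipartite n) d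
  (λ i j → singleVoltage (label i) (label j))
  (λ i j → singleVoltage-inverse (label i) (label j))

IsLargestPower : ℕ → ℕ → ℕ → Set
IsLargestPower p a m = p ^ a ∣ m × (∀ k → p ^ k ∣ m → k ≤ a)

{-# OPTIONS --safe #-}
module Submission where

-- Let τ generate the deck group, let R = ℤ[τ]/(τ^d − 1) and N = 1 + τ + … + τ^(d−1). All rows of
-- the Laplacian except those at the fibres of v₁ and v₂ can be solved for one unknown after
-- inverting n, and eliminating these unknowns presents the cokernel of the Laplacian as the cyclic
-- module R/((n − 1)² (τ − 1)²). Its degree-zero part is generated by τ − 1, hence is isomorphic to
-- R/(N, (n − 1)² (τ − 1)), a sum of d − 2 copies of ℤ/(n − 1)² and one of ℤ/d(n − 1)².
-- Integrally, this gives a map from the Jacobian to the p-part of that sum whose kernel and cokernel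
-- are annihilated by integers prime to p, so it is an isomorphism on the Sylow p-subgroup.

open import Defs
open import Algebra.Bundles using (AbelianGroup)
open import Algebra.Morphism.Structures using (module GroupMorphisms)
import Algebra.Properties.AbelianGroup as AbelianGroupProperties
import Algebra.Properties.CommutativeMonoid.Mult as Mult
open import Data.Bool using (true; false; _∧_; if_then_else_)
open import Data.Empty using (⊥-elim)
open import Data.Fin as Fin
  using (Fin; zero; suc; toℕ; fromℕ; fromℕ<; inject₁; punchIn; combine; remQuot; finToFun; funToFin; _↑ˡ_; _↑ʳ_)
open import Data.Fin.Permutation using (permutation)
open import Data.Fin.Properties
  using (toℕ<n; toℕ-fromℕ; toℕ-fromℕ<; toℕ-inject₁; toℕ-injective; combine-injective; combine-remQuot;
         remQuot-combine; finToFun-funToFin; funToFin-finToFin; injective⇒≤)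
open import Data.Integer as ℤ using (ℤ; +_; -[1+_]; 0ℤ; 1ℤ; -1ℤ)
open import Data.Integer.DivMod using (_%ℕ_; _/ℕ_; n%ℕd<d; a≡a%ℕn+[a/ℕn]*n)
import Data.Integer.Divisibility.Signed as ℤ∣
import Data.Integer.Properties as ℤ
open import Data.Integer.Tactic.RingSolver using (solve-∀)
open import Data.Nat as ℕ
  using (ℕ; zero; suc; pred; _+_; _*_; _∸_; _^_; _≤_; _<_; s≤s; NonZero)
open import Data.Nat.Coprimality using (Coprime; coprime-Bézout; coprime-divisor)
open import Data.Nat.Divisibility
  using (_∣_; _∤_; _∣?_; divides; ∣-refl; ∣-trans; ∣1⇒≡1; ∣m∣n⇒∣m+n; ∣m+n∣m⇒∣n; m∣m*n; >⇒∤)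
open import Data.Nat.GCD using (module Bézout)
open import Data.Nat.Primality
  using (Prime; prime⇒irreducible; prime⇒nonZero; prime⇒nonTrivial; euclidsLemma)
import Data.Nat.Properties as ℕ
open import Data.Product using (∃; _×_; _,_; proj₁; proj₂)
open import Data.Sum using (_⊎_; inj₁; inj₂; [_,_])
open import Data.Vec.Functional using (insertAt; removeAt)
open import Data.Vec.Functional.Properties using (insertAt-lookup; insertAt-punchIn; insertAt-removeAt)
open import Function using (_∘_; Inverse; mk⇔)
open import Relation.Binary.PropositionalEquality
  using (_≡_; refl; sym; trans; cong; cong₂; subst; module ≡-Reasoning)
open import Relation.Nullary using (does; ¬?; contradiction; contraposition)
open import Relation.Nullary.Decidable using (does-⇔)

import Algebra.Properties.Semiring.Sum ℤ.+-*-semiring as ℤΣ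

-- Abelian groups and their Sylow subgroups

-- No localization is formed. Each division by n becomes a multiplication, so the kernel is only
-- shown to be killed by n³κ and the image only to contain n² times the target, where κ is the
-- prime-to-p part of d(n - 1)²; p-torsion does not see these constants.
--
-- Passing from the degree-zero part to R/(N, (n - 1)² (τ - 1)) amounts to dividing by τ - 1. Here
-- this is a summation: the sums of a degree-zero vector over the sheets g of the cover add up to 0
-- around the cycle, so they have an antidifference, unique up to a constant. Functions on the cycle
-- modulo constants are R/(N).
--
-- The factor d in the last summand arises as an index: the relations are (n - 1)² times the
-- functions of total 0, and these functions together with the constants have index d in ℤ^d.

∤⇒coprime : ∀ {p m} → Prime p → p ∤ m → Coprime p m
∤⇒coprime p-prime p∤m {d} (d∣p , d∣m) with prime⇒irreducible p-prime d∣p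
... | inj₁ d≡1 = d≡1
... | inj₂ refl = ⊥-elim (p∤m d∣m)

coprime-^ : ∀ {p m} → Coprime p m → ∀ k → Coprime (p ^ k) m
coprime-^ c zero (d∣1 , _) = ∣1⇒≡1 d∣1
coprime-^ {p} c (suc k) {d} (d∣pᵏ⁺¹ , d∣m) =
  coprime-^ c k (coprime-divisor coprime-d d∣pᵏ⁺¹ , d∣m)
  where
  coprime-d : Coprime d p
  coprime-d (e∣d , e∣p) = c (e∣p , ∣-trans e∣d d∣m)

∤-* : ∀ {p m n} → Prime p → p ∤ m → p ∤ n → p ∤ m * n
∤-* {m = m} {n} p-prime p∤m p∤n p∣mn = [ p∤m , p∤n ] (euclidsLemma m n p-prime p∣mn)

module Multiples (A : Ab) where
  open AbelianGroup A hiding (refl; sym; trans)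
  private module A = AbelianGroup A
  open Mult commutativeMonoid public
    using (×-congʳ; ×-congˡ; ×-assocˡ; ×-homo-+; ×-distrib-+) renaming (_×_ to _·_)
  open AbelianGroupProperties A
  open import Relation.Binary.Reasoning.Setoid setoid

  ·-zeroʳ : ∀ n → n · ε ≈ ε
  ·-zeroʳ zero    = A.refl
  ·-zeroʳ (suc n) = A.trans (identityˡ _) (·-zeroʳ n)

  ·-comm : ∀ m n x → m · (n · x) ≈ n · (m · x)
  ·-comm m n x = begin
    m · (n · x)  ≈⟨ ×-assocˡ x m n ⟩
    (m * n) · x  ≈⟨ ×-congˡ (ℕ.*-comm m n) ⟩
    (n * m) · x  ≈⟨ ×-assocˡ x n m ⟨
    n · (m · x)  ∎

  ·-annihilated : ∀ m n {x} → n · x ≈ ε → (m * n) · x ≈ ε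
  ·-annihilated m n {x} nx≈ε = begin
    (m * n) · x  ≈⟨ ×-assocˡ x m n ⟨
    m · (n · x)  ≈⟨ ×-congʳ m nx≈ε ⟩
    m · ε        ≈⟨ ·-zeroʳ m ⟩
    ε            ∎

  coprime-annihilators : ∀ {m n x} → Coprime m n → m · x ≈ ε → n · x ≈ ε → x ≈ ε
  coprime-annihilators {m} {n} {x} coprime mx≈ε nx≈ε with coprime-Bézout coprime
  ... | Bézout.+- u v eq = begin
    x                    ≈⟨ identityʳ x ⟨
    x ∙ ε                ≈⟨ ∙-congˡ (·-annihilated v n nx≈ε) ⟨
    (1 + v * n) · x      ≈⟨ ×-congˡ eq ⟩
    (u * m) · x          ≈⟨ ·-annihilated u m mx≈ε ⟩
    ε                    ∎
  ... | Bézout.-+ u v eq = begin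
    x                    ≈⟨ identityʳ x ⟨
    x ∙ ε                ≈⟨ ∙-congˡ (·-annihilated u m mx≈ε) ⟨
    (1 + u * m) · x      ≈⟨ ×-congˡ eq ⟩
    (v * n) · x          ≈⟨ ·-annihilated v n nx≈ε ⟩
    ε                    ∎

  ·-⁻¹ : ∀ n x → n · (x ⁻¹) ≈ (n · x) ⁻¹
  ·-⁻¹ n x = inverseʳ-unique (n · x) (n · (x ⁻¹)) (begin
    n · x ∙ n · (x ⁻¹)  ≈⟨ ×-distrib-+ x (x ⁻¹) n ⟨
    n · (x ∙ x ⁻¹)      ≈⟨ ×-congʳ n (inverseʳ x) ⟩
    n · ε               ≈⟨ ·-zeroʳ n ⟩
    ε                   ∎)

  -- Multiplication by n is invertible on m-torsion. Bézout over the naturals reads either 1 + vn =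
  -- um or 1 + um = vn, so the inverse is -v in the first case and v in the second.
  divide : ∀ {m n x} → Coprime m n → m · x ≈ ε → ∃ λ y → n · y ≈ x
  divide {m} {n} {x} coprime mx≈ε with coprime-Bézout coprime
  ... | Bézout.+- u v eq = (v · x) ⁻¹ , (begin
    n · ((v · x) ⁻¹)     ≈⟨ ·-⁻¹ n (v · x) ⟩
    (n · (v · x)) ⁻¹     ≈⟨ inverseˡ-unique x (n · (v · x)) (begin
      x ∙ n · (v · x)      ≈⟨ ∙-congˡ (·-comm n v x) ⟩
      x ∙ v · (n · x)      ≈⟨ ∙-congˡ (×-assocˡ x v n) ⟩
      (1 + v * n) · x      ≈⟨ ×-congˡ eq ⟩
      (u * m) · x          ≈⟨ ·-annihilated u m mx≈ε ⟩
      ε                    ∎) ⟨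
    x                    ∎)
  ... | Bézout.-+ u v eq = v · x , (begin
    n · (v · x)          ≈⟨ ·-comm n v x ⟩
    v · (n · x)          ≈⟨ ×-assocˡ x v n ⟩
    (v * n) · x          ≈⟨ ×-congˡ eq ⟨
    x ∙ (u * m) · x      ≈⟨ ∙-congˡ (·-annihilated u m mx≈ε) ⟩
    x ∙ ε                ≈⟨ identityʳ x ⟩
    x                    ∎)

module _ (A B : Ab) where
  private
    module A = AbelianGroup A
    module B = AbelianGroup B
    module MA = Multiples A
    module MB = Multiples B
    open MA using () renaming (_·_ to _·ᴬ_)
    open MB using () renaming (_·_ to _·ᴮ_)
  open GroupMorphisms A.rawGroup B.rawGroup

  module Additive
    (φ : A.Carrier → B.Carrier)
    (φ-cong : ∀ {x y} → x A.≈ y → φ x B.≈ φ y)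
    (φ-homo : ∀ x y → φ (x A.∙ y) B.≈ φ x B.∙ φ y)
    where
    open AbelianGroupProperties B
    open import Relation.Binary.Reasoning.Setoid B.setoid

    φ-ε : φ A.ε B.≈ B.ε
    φ-ε = identityˡ-unique (φ A.ε) (φ A.ε) (B.trans (B.sym (φ-homo A.ε A.ε)) (φ-cong (A.identityˡ A.ε)))

    φ-⁻¹ : ∀ x → φ (x A.⁻¹) B.≈ φ x B.⁻¹
    φ-⁻¹ x = inverseʳ-unique (φ x) (φ (x A.⁻¹)) (begin
      φ x B.∙ φ (x A.⁻¹)  ≈⟨ φ-homo x (x A.⁻¹) ⟨
      φ (x A.∙ x A.⁻¹)    ≈⟨ φ-cong (A.inverseʳ x) ⟩
      φ A.ε               ≈⟨ φ-ε ⟩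
      B.ε                 ∎)

    φ-· : ∀ n x → φ (n ·ᴬ x) B.≈ n ·ᴮ φ x
    φ-· zero    x = φ-ε
    φ-· (suc n) x = B.trans (φ-homo x (n ·ᴬ x)) (B.∙-congˡ (φ-· n x))

    isGroupHomomorphism : IsGroupHomomorphism φ
    isGroupHomomorphism = record
      { isMonoidHomomorphism = record
        { isMagmaHomomorphism = record { isRelHomomorphism = record { cong = φ-cong } ; homo = φ-homo }
        ; ε-homo = φ-ε }
      ; ⁻¹-homo = φ-⁻¹ }

    kernel⇒injective : (∀ x → φ x B.≈ B.ε → x A.≈ A.ε) → ∀ {x y} → φ x B.≈ φ y → x A.≈ y
    kernel⇒injective kernel {x} {y} φx≈φy = A-props.x∙y⁻¹≈ε⇒x≈y x y (kernel _ (begin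
      φ (x A.∙ y A.⁻¹)    ≈⟨ φ-homo x (y A.⁻¹) ⟩
      φ x B.∙ φ (y A.⁻¹)  ≈⟨ B.∙-cong φx≈φy (φ-⁻¹ y) ⟩
      φ y B.∙ φ y B.⁻¹    ≈⟨ B.inverseʳ (φ y) ⟩
      B.ε                 ∎))
      where module A-props = AbelianGroupProperties A

module _ (A B : Ab) where
  private
    module A = AbelianGroup A
    module B = AbelianGroup B
    module MA = Multiples A
    module MB = Multiples B
    open MA using () renaming (_·_ to _·ᴬ_)
    open MB using () renaming (_·_ to _·ᴮ_)

  -- A kernel killed by c contains no p-torsion, which gives injectivity. For surjectivity, c and c′
  -- are invertible on `B` because `B` is killed by a power of p, so every b is of the form cc′b′.
  sylow-≅ :
    ∀ {p e c c′} → Prime p → p ∤ c → p ∤ c′ →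
    (φ : A.Carrier → B.Carrier) →
    (∀ {x y} → x A.≈ y → φ x B.≈ φ y) →
    (∀ x y → φ (x A.∙ y) B.≈ φ x B.∙ φ y) →
    (∀ x → φ x B.≈ B.ε → c ·ᴬ x A.≈ A.ε) →
    (∀ b → ∃ λ x → φ x B.≈ c′ ·ᴮ b) →
    (∀ b → (p ^ e) ·ᴮ b B.≈ B.ε) →
    Sylow p A ≅ B
  sylow-≅ {p} {e} {c} {c′} p-prime p∤c p∤c′ φ φ-cong φ-homo kernel image exponent =
    (λ x → φ (proj₁ x)) , record
    { isGroupMonomorphism = record
      { isGroupHomomorphism = Sylowφ.isGroupHomomorphism
      ; injective = λ {x} {y} → Sylowφ.kernel⇒injective sylow-kernel {x} {y} }
    ; surjective = λ b → let x , φx≈b = preimage b in x , λ {z} z≈x → B.trans (φ-cong z≈x) φx≈b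
    }
    where
    module Aφ = Additive A B φ φ-cong φ-homo
    module Sylowφ = Additive (Sylow p A) B (λ x → φ (proj₁ x)) (λ x≈y → φ-cong x≈y)
      (λ x y → φ-homo (proj₁ x) (proj₁ y))
    module S = AbelianGroup (Sylow p A)

    sylow-kernel : ∀ x → φ (proj₁ x) B.≈ B.ε → x S.≈ S.ε
    sylow-kernel (x , k , pᵏx≈ε) φx≈ε =
      MA.coprime-annihilators (coprime-^ (∤⇒coprime p-prime p∤c) k) pᵏx≈ε (kernel x φx≈ε)

    preimage : ∀ b → ∃ λ x → φ (proj₁ {B = λ x → ∃ λ k → (p ^ k) ·ᴬ x A.≈ A.ε} x) B.≈ b
    preimage b with MB.divide (coprime-^ (∤⇒coprime p-prime (∤-* p-prime p∤c p∤c′)) e) (exponent b)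
    ... | b′ , cc′b′≈b with image b′
    -- The preimage x₀ of c′b′ need not be p-torsion, but p^e x₀ lies in the kernel of φ and is
    -- killed by c. Hence c x₀ is p-torsion, and it maps to cc′b′ = b.
    ... | x₀ , φx₀≈c′b′ = (c ·ᴬ x₀ , e , torsion) , (begin
      φ (c ·ᴬ x₀)      ≈⟨ Aφ.φ-· c x₀ ⟩
      c ·ᴮ φ x₀        ≈⟨ MB.×-congʳ c φx₀≈c′b′ ⟩
      c ·ᴮ (c′ ·ᴮ b′)  ≈⟨ MB.×-assocˡ b′ c c′ ⟩
      (c * c′) ·ᴮ b′   ≈⟨ cc′b′≈b ⟩
      b                ∎)
      where
      open import Relation.Binary.Reasoning.Setoid B.setoid
      torsion : (p ^ e) ·ᴬ (c ·ᴬ x₀) A.≈ A.ε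
      torsion = A.trans (MA.·-comm (p ^ e) c x₀) (kernel _ (begin
        φ ((p ^ e) ·ᴬ x₀)  ≈⟨ Aφ.φ-· (p ^ e) x₀ ⟩
        (p ^ e) ·ᴮ φ x₀    ≈⟨ MB.×-congʳ (p ^ e) φx₀≈c′b′ ⟩
        (p ^ e) ·ᴮ (c′ ·ᴮ b′)  ≈⟨ MB.·-comm (p ^ e) c′ b′ ⟩
        c′ ·ᴮ ((p ^ e) ·ᴮ b′)  ≈⟨ MB.×-congʳ c′ (exponent b′) ⟩
        c′ ·ᴮ B.ε          ≈⟨ MB.·-zeroʳ c′ ⟩
        B.ε                ∎))

-- Orders and numbers of generators

residue : ∀ m .{{_ : NonZero m}} → ℤ → Fin m
residue m z = fromℕ< (n%ℕd<d z m)

residue-∣ : ∀ m .{{_ : NonZero m}} z → + m ℤ∣.∣ z ℤ.- + toℕ (residue m z)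
residue-∣ m z = ℤ∣.divides (z /ℕ m) (begin
  z ℤ.- + toℕ (residue m z)               ≡⟨ cong (λ r → z ℤ.- + r) (toℕ-fromℕ< (n%ℕd<d z m)) ⟩
  z ℤ.- + r                               ≡⟨ cong (ℤ._- + r) (a≡a%ℕn+[a/ℕn]*n z m) ⟩
  + r ℤ.+ (z /ℕ m) ℤ.* + m ℤ.- + r        ≡⟨ cancel (+ r) ((z /ℕ m) ℤ.* + m) ⟩
  (z /ℕ m) ℤ.* + m                        ∎)
  where
  open ≡-Reasoning
  r = z %ℕ m
  cancel : ∀ x y → x ℤ.+ y ℤ.- x ≡ y
  cancel = solve-∀

∣-small⇒≡0 : ∀ {m k} → m ∣ k → k < m → k ≡ 0
∣-small⇒≡0 {k = zero}  _   _   = refl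
∣-small⇒≡0 {k = suc k} m∣k k<m = contradiction m∣k (>⇒∤ k<m)

-- Both values lie below m, so their difference is below m in absolute value and is a multiple of m
-- only if it vanishes.
toℕ-unique : ∀ {m} (i j : Fin m) → + m ℤ∣.∣ + toℕ i ℤ.- + toℕ j → i ≡ j
toℕ-unique {m} i j m∣i-j = toℕ-injective (ℤ.+-injective (ℤ.i-j≡0⇒i≡j _ _ (ℤ.∣i∣≡0⇒i≡0
  (∣-small⇒≡0 (ℤ∣.∣⇒∣ᵤ m∣i-j) (ℕ.≤-<-trans ∣i-j∣≤ (ℕ.⊔-lub (toℕ<n i) (toℕ<n j)))))))
  where
  ∣i-j∣≤ : ℤ.∣ + toℕ i ℤ.- + toℕ j ∣ ≤ toℕ i ℕ.⊔ toℕ j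
  ∣i-j∣≤ = subst (λ z → ℤ.∣ z ∣ ≤ toℕ i ℕ.⊔ toℕ j) (sym (ℤ.m-n≡m⊖n (toℕ i) (toℕ j)))
    (ℤ.∣m⊝n∣≤m⊔n (toℕ i) (toℕ j))

funToFin-cong : ∀ {m n} {f g : Fin m → Fin n} → (∀ i → f i ≡ g i) → funToFin f ≡ funToFin g
funToFin-cong {zero}  f≗g = refl
funToFin-cong {suc m} f≗g = cong₂ combine (f≗g zero) (funToFin-cong (f≗g ∘ suc))

module _ (A : Ab) where
  open AbelianGroup A hiding (refl; sym; trans)
  private module A = AbelianGroup A

  -- Injectivity of `to` up to ≈ supplies the second inverse law.
  hasOrder : ∀ {N} (to : Carrier → Fin N) (from : Fin N → Carrier) →
    (∀ {x y} → x ≈ y → to x ≡ to y) → (∀ {x y} → to x ≡ to y → x ≈ y) →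
    (∀ i → to (from i) ≡ i) → HasOrder A N
  hasOrder to from to-cong to-injective to∘from = record
    { to        = to
    ; from      = from
    ; to-cong   = to-cong
    ; from-cong = λ { refl → A.refl }
    ; inverse   = (λ {i} y≈from → trans (to-cong y≈from) (to∘from i))
                , (λ { refl → to-injective (to∘from _) })
    }

  module HasOrderProperties {N} (order : HasOrder A N) where
    open Inverse order public using (to; from; to-cong; strictlyInverseˡ; strictlyInverseʳ)

    to-injective : ∀ {x y} → to x ≡ to y → x ≈ y
    to-injective {x} {y} e = A.trans (A.sym (strictlyInverseʳ x))
      (A.trans (A.reflexive (cong from e)) (strictlyInverseʳ y))

hasOrder-ℤ/ : ∀ m .{{_ : NonZero m}} → HasOrder (ℤ/ m) m
hasOrder-ℤ/ m = hasOrder (ℤ/ m) (residue m) (λ i → + toℕ i)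
  (λ {x} {y} x≈y → toℕ-unique _ _ (Z.trans {+ toℕ (residue m x)} {x} (Z.sym {x} (residue-∣ m x))
     (Z.trans {x} {y} x≈y (residue-∣ m y))))
  (λ {x} {y} e → Z.trans {x} {+ toℕ (residue m x)} {y} (residue-∣ m x)
     (subst (λ i → + toℕ i Z.≈ y) (sym e) (Z.sym {y} (residue-∣ m y))))
  (λ i → toℕ-unique _ _ (Z.sym {+ toℕ i} {+ toℕ (residue m (+ toℕ i))} (residue-∣ m (+ toℕ i))))
  where module Z = AbelianGroup (ℤ/ m)

hasOrder-⊕ : ∀ {A B M N} → HasOrder A M → HasOrder B N → HasOrder (A ⊕ B) (M * N)
hasOrder-⊕ {A} {B} {M} {N} orderA orderB = hasOrder (A ⊕ B)
  (λ (x , y) → combine (OA.to x) (OB.to y))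
  (λ k → OA.from (proj₁ (remQuot {M} N k)) , OB.from (proj₂ (remQuot {M} N k)))
  (λ (x≈x′ , y≈y′) → cong₂ combine (OA.to-cong x≈x′) (OB.to-cong y≈y′))
  (λ e → let ex , ey = combine-injective _ _ _ _ e in OA.to-injective ex , OB.to-injective ey)
  (λ k → trans (cong₂ combine (OA.strictlyInverseˡ _) (OB.strictlyInverseˡ _)) (combine-remQuot {M} N k))
  where
  module OA = HasOrderProperties A orderA
  module OB = HasOrderProperties B orderB

hasOrder-^⊕ : ∀ {A M} k → HasOrder A M → HasOrder (A ^⊕ k) (M ^ k)
hasOrder-^⊕ {A} {M} k orderA = hasOrder (A ^⊕ k)
  (λ f → funToFin (OA.to ∘ f))
  (λ j → OA.from ∘ finToFun {M} {k} j)
  (λ f≈g → funToFin-cong (λ i → OA.to-cong (f≈g i)))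
  (λ {f} {g} e i → OA.to-injective (trans (sym (finToFun-funToFin (OA.to ∘ f) i))
    (trans (cong (λ j → finToFun {M} {k} j i) e) (finToFun-funToFin (OA.to ∘ g) i))))
  (λ j → trans (funToFin-cong {k} (λ i → OA.strictlyInverseˡ (finToFun {M} {k} j i))) (funToFin-finToFin {k} {M} j))
  where module OA = HasOrderProperties A orderA

module _ {A B : Ab} (A≅B : A ≅ B) where
  private
    module A = AbelianGroup A
    module B = AbelianGroup B
    φ = proj₁ A≅B
    module φ where
      open GroupMorphisms.IsGroupIsomorphism (proj₂ A≅B) public
      open GroupMorphisms.IsGroupHomomorphism isGroupHomomorphism public using (homo)
    pre : B.Carrier → A.Carrier
    pre b = proj₁ (φ.surjective b)
    φ-pre : ∀ b → φ (pre b) B.≈ b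
    φ-pre b = proj₂ (φ.surjective b) A.refl

  ≅-hasOrder : ∀ {N} → HasOrder B N → HasOrder A N
  ≅-hasOrder orderB = hasOrder A (OB.to ∘ φ) (pre ∘ OB.from)
    (λ x≈y → OB.to-cong (φ.⟦⟧-cong x≈y))
    (λ e → φ.injective (OB.to-injective e))
    (λ i → trans (OB.to-cong (φ-pre (OB.from i))) (OB.strictlyInverseˡ i))
    where module OB = HasOrderProperties B orderB

  ≅-generates : ∀ {k} {g : Fin k → B.Carrier} → Generates B g → Generates A (pre ∘ g)
  ≅-generates {g = g} generates x = pullback (generates (φ x)) B.refl
    where
    -- The induction on the derivation ranges over every preimage x of b, so that `equal` costs only
    -- transitivity and the other cases reduce to the chosen preimages `pre b`.
    pullback : ∀ {b} → Generated B g b → ∀ {x} → φ x B.≈ b → Generated A (pre ∘ g) x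
    pullback (gen i) φx≈b =
      equal (φ.injective (B.trans (φ-pre _) (B.sym φx≈b))) (gen i)
    pullback unit φx≈b = equal (φ.injective (B.trans φ.ε-homo (B.sym φx≈b))) unit
    pullback (mult {b} {c} p q) φx≈b = equal
      (φ.injective (B.trans (φ.homo (pre b) (pre c)) (B.trans (B.∙-cong (φ-pre b) (φ-pre c)) (B.sym φx≈b))))
      (mult (pullback p (φ-pre b)) (pullback q (φ-pre c)))
    pullback (inv {b} p) φx≈b = equal
      (φ.injective (B.trans (φ.⁻¹-homo (pre b)) (B.trans (B.⁻¹-cong (φ-pre b)) (B.sym φx≈b))))
      (inv (pullback p (φ-pre b)))
    pullback (equal b≈c p) φx≈c = pullback p (B.trans φx≈c (B.sym b≈c))

single : ∀ {k} → Fin k → ℤ → Fin k → ℤ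
single zero    z zero    = z
single zero    z (suc j) = 0ℤ
single (suc i) z zero    = 0ℤ
single (suc i) z (suc j) = single i z j

single-+ : ∀ {k} (i : Fin k) x y j → single i (x ℤ.+ y) j ≡ single i x j ℤ.+ single i y j
single-+ zero    x y zero    = refl
single-+ zero    x y (suc j) = refl
single-+ (suc i) x y zero    = refl
single-+ (suc i) x y (suc j) = single-+ i x y j

sum-zero : ∀ {k} {f : Fin k → ℤ} → (∀ i → f i ≡ 0ℤ) → ℤΣ.sum f ≡ 0ℤ
sum-zero {k} f≡0 = trans (ℤΣ.sum-cong-≗ f≡0) (ℤΣ.sum-replicate-zero k)

sum-single : ∀ {k} (i : Fin k) z (f : Fin k → ℤ) → ℤΣ.sum (λ j → single i z j ℤ.* f j) ≡ z ℤ.* f i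
sum-single zero z f = trans
  (cong (λ s → z ℤ.* f zero ℤ.+ s) (sum-zero (λ j → ℤ.*-zeroˡ (f (suc j))))) (ℤ.+-identityʳ _)
sum-single (suc i) z f = trans
  (cong₂ ℤ._+_ (ℤ.*-zeroˡ (f zero)) (sum-single i z (f ∘ suc))) (ℤ.+-identityˡ _)

module _ (B : Ab) where
  open AbelianGroup B hiding (refl; sym; trans)

  multiples-generated : ∀ {k} {g : Fin k → Carrier} (h : ℤ → Carrier) →
    (∀ x y → h (x ℤ.+ y) ≈ h x ∙ h y) → Generated B g (h 1ℤ) → ∀ z → Generated B g (h z)
  multiples-generated {g = g} h h-homo h1 = go
    where
    h-cong : ∀ {x y} → x ≡ y → h x ≈ h y
    h-cong refl = AbelianGroup.refl B
    open Additive ℤ.+-0-abelianGroup B h h-cong h-homo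
    natural : ∀ n → Generated B g (h (+ n))
    natural zero    = equal (AbelianGroup.sym B φ-ε) unit
    natural (suc n) = equal (AbelianGroup.sym B (h-homo 1ℤ (+ n))) (mult h1 (natural n))
    go : ∀ z → Generated B g (h z)
    go (+ n)    = natural n
    go -[1+ n ] = equal (AbelianGroup.sym B (φ-⁻¹ (+ suc n))) (inv (natural (suc n)))

-- Splitting off the head entry leaves the tail preceded by a zero, and induction applies to the
-- predicate pulled back along `extend`. Closure of `S` under pointwise equality replaces function
-- extensionality.
singles-suffice : ∀ {k} (S : (Fin k → ℤ) → Set) →
  (∀ {f g} → (∀ i → f i ≡ g i) → S f → S g) → S (λ _ → 0ℤ) →
  (∀ {f g} → S f → S g → S (λ i → f i ℤ.+ g i)) →
  (∀ i z → S (single i z)) → ∀ f → S f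
singles-suffice {zero}  S resp S0 S+ S1 f = resp (λ ()) S0
singles-suffice {suc k} S resp S0 S+ S1 f = resp
  (λ { zero → ℤ.+-identityʳ (f zero) ; (suc i) → ℤ.+-identityˡ (f (suc i)) })
  (S+ (S1 zero (f zero)) (singles-suffice (S ∘ extend)
    (λ f≗g → resp (λ { zero → refl ; (suc i) → f≗g i }))
    (resp (λ { zero → refl ; (suc i) → refl }) S0)
    (λ Sf Sg → resp (λ { zero → refl ; (suc i) → refl }) (S+ Sf Sg))
    (λ i z → resp (λ { zero → refl ; (suc j) → refl }) (S1 (suc i) z))
    (f ∘ suc)))
  where
  extend : (Fin k → ℤ) → Fin (suc k) → ℤ
  extend g zero    = 0ℤ
  extend g (suc i) = g i

module _ (M N k : ℕ) where
  private
    B = (ℤ/ M) ^⊕ k ⊕ (ℤ/ N)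
    module B = AbelianGroup B
    module M = AbelianGroup (ℤ/ M)
    module N = AbelianGroup (ℤ/ N)

  standardBasis : Fin (suc k) → B.Carrier
  standardBasis zero    = (λ _ → 0ℤ) , 1ℤ
  standardBasis (suc i) = single i 1ℤ , 0ℤ

  standardBasis-generates : Generates B standardBasis
  standardBasis-generates (f , z) = equal
    ((λ i → M.reflexive (ℤ.+-identityʳ (f i))) , N.reflexive (ℤ.+-identityˡ z))
    (mult
      (singles-suffice (λ g → Generated B standardBasis (g , 0ℤ))
        (λ g≗h → equal ((λ i → M.reflexive (g≗h i)) , N.refl {0ℤ}))
        unit
        mult
        (λ i → multiples-generated B (λ x → single i x , 0ℤ)
          (λ x y → (λ j → M.reflexive (single-+ i x y j)) , N.refl {0ℤ}) (gen (suc i)))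
        f)
      (multiples-generated B (λ x → (λ _ → 0ℤ) , x)
        (λ x y → (λ j → M.refl {0ℤ}) , N.refl {x ℤ.+ y}) (gen zero) z))

module _ {p} (p-prime : Prime p) (A : Ab) {r : ℕ} where
  private
    module A = AbelianGroup A
    module Z = AbelianGroup (ℤ/ p)
    module C = AbelianGroup ((ℤ/ p) ^⊕ r)
    instance
      p≢0 : NonZero p
      p≢0 = prime⇒nonZero p-prime

  -- Counting: the k coefficients modulo p of an element determine its image in (ℤ/p)^r.
  elementary-quotient⇒rank≥ :
    (φ : A.Carrier → C.Carrier) →
    (∀ {x y} → x A.≈ y → φ x C.≈ φ y) →
    (∀ x y → φ (x A.∙ y) C.≈ φ x C.∙ φ y) →
    (∀ c → ∃ λ x → φ x C.≈ c) →
    ∀ {k} (g : Fin k → A.Carrier) → Generates A g → r ≤ k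
  elementary-quotient⇒rank≥ φ φ-cong φ-homo surjective {k} g generates =
    -- With k < r, `encode` would inject p^r elements into the smaller set of p^k coefficient
    -- vectors.
    ℕ.≮⇒≥ λ k<r → ℕ.<⇒≱ (ℕ.^-monoʳ-< p (ℕ.nonTrivial⇒n>1 p {{prime⇒nonTrivial p-prime}}) k<r)
      (injective⇒≤ encode-injective)
    where
    open Additive A ((ℤ/ p) ^⊕ r) φ φ-cong φ-homo using (φ-ε; φ-⁻¹)

    combination : (Fin k → ℤ) → Fin r → ℤ
    combination c i = ℤΣ.sum (λ j → c j ℤ.* φ (g j) i)

    combination-single : ∀ j i → combination (single j 1ℤ) i ≡ φ (g j) i
    combination-single j i = trans (sum-single j 1ℤ (λ j → φ (g j) i)) (ℤ.*-identityˡ _)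

    combination-+ : ∀ c d i → combination (λ j → c j ℤ.+ d j) i ≡ combination c i ℤ.+ combination d i
    combination-+ c d i = trans
      (ℤΣ.sum-cong-≗ (λ j → ℤ.*-distribʳ-+ (φ (g j) i) (c j) (d j)))
      (ℤΣ.∑-distrib-+ (λ j → c j ℤ.* φ (g j) i) (λ j → d j ℤ.* φ (g j) i))

    combination-* : ∀ z c i → combination (λ j → z ℤ.* c j) i ≡ z ℤ.* combination c i
    combination-* z c i = trans
      (ℤΣ.sum-cong-≗ (λ j → ℤ.*-assoc z (c j) (φ (g j) i)))
      (sym (ℤΣ.*-distribˡ-sum z (λ j → c j ℤ.* φ (g j) i)))

    -- The difference of the two coefficient vectors is p times the vector of quotients, and
    -- `combination` is linear.
    combination-cong : ∀ {c d} → (∀ j → c j Z.≈ d j) → combination c C.≈ combination d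
    combination-cong {c} {d} c≈d i = subst (+ p ℤ∣.∣_) difference
      (multiples (λ j → ℤ∣._∣_.quotient (c≈d j)) (λ j → ℤ∣._∣_.equality (c≈d j)))
      where
      multiples : ∀ q → (∀ j → c j ℤ.- d j ≡ q j ℤ.* + p) → + p ℤ∣.∣ combination (λ j → c j ℤ.- d j) i
      multiples q e = ℤ∣.divides (combination q i) (trans
        (ℤΣ.sum-cong-≗ (λ j → cong (ℤ._* φ (g j) i) (trans (e j) (ℤ.*-comm (q j) (+ p)))))
        (trans (combination-* (+ p) q i) (ℤ.*-comm (+ p) _)))
      difference : combination (λ j → c j ℤ.- d j) i ≡ combination c i ℤ.- combination d i
      difference = trans (combination-+ c (ℤ.-_ ∘ d) i) (cong (λ s → combination c i ℤ.+ s) (trans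
        (ℤΣ.sum-cong-≗ (λ j → cong (ℤ._* φ (g j) i) (sym (ℤ.-1*i≡-i (d j)))))
        (trans (combination-* ℤ.-1ℤ d i) (ℤ.-1*i≡-i _))))

    coefficients : ∀ {x} → Generated A g x → ∃ λ c → φ x C.≈ combination c
    coefficients (gen j) = single j 1ℤ , C.sym {combination (single j 1ℤ)} {φ (g j)} (λ i → Z.reflexive (combination-single j i))
    coefficients unit = (λ _ → 0ℤ) , C.trans {φ A.ε} {λ _ → 0ℤ} φ-ε (λ i → Z.reflexive (sym (sum-zero (λ j → ℤ.*-zeroˡ (φ (g j) i)))))
    coefficients (mult {x} {y} p q) with coefficients p | coefficients q
    ... | c , φx≈c | d , φy≈d = (λ j → c j ℤ.+ d j) , C.trans {φ (x A.∙ y)} (φ-homo x y)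
      (C.trans {φ x C.∙ φ y} (C.∙-cong {φ x} {combination c} {φ y} {combination d} φx≈c φy≈d)
        (λ i → Z.reflexive (sym (combination-+ c d i))))
    coefficients (inv {x} p) with coefficients p
    ... | c , φx≈c = (λ j → ℤ.-1ℤ ℤ.* c j) , C.trans {φ (x A.⁻¹)} (φ-⁻¹ x)
      (C.trans {φ x C.⁻¹} (C.⁻¹-cong {φ x} {combination c} φx≈c)
        (λ i → Z.reflexive (trans (sym (ℤ.-1*i≡-i _)) (sym (combination-* ℤ.-1ℤ c i)))))
    coefficients (equal {x} {y} x≈y p) with coefficients p
    ... | c , φx≈c = c , C.trans {φ y} {φ x} (φ-cong (A.sym x≈y)) φx≈c

    lift : (Fin r → Fin p) → A.Carrier
    lift v = proj₁ (surjective (λ i → + toℕ (v i)))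

    coordinates : (Fin r → Fin p) → Fin k → ℤ
    coordinates v = proj₁ (coefficients (generates (lift v)))

    coordinates-determine : ∀ v → (λ i → + toℕ (v i)) C.≈ combination (coordinates v)
    coordinates-determine v = C.trans {λ i → + toℕ (v i)} {φ (lift v)}
      (C.sym {φ (lift v)} (proj₂ (surjective (λ i → + toℕ (v i)))))
      (proj₂ (coefficients (generates (lift v))))

    encode : Fin (p ^ r) → Fin (p ^ k)
    encode n = funToFin (residue p ∘ coordinates (finToFun n))

    encode-injective : ∀ {m n} → encode m ≡ encode n → m ≡ n
    encode-injective {m} {n} e = begin
      m                               ≡⟨ funToFin-finToFin {r} {p} m ⟨
      funToFin (finToFun {p} {r} m)   ≡⟨ funToFin-cong (λ i → toℕ-unique _ _ (same i)) ⟩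
      funToFin (finToFun {p} {r} n)   ≡⟨ funToFin-finToFin {r} {p} n ⟩
      n                               ∎
      where
      open ≡-Reasoning
      u = finToFun {p} {r} m
      v = finToFun {p} {r} n
      residues : ∀ j → residue p (coordinates u j) ≡ residue p (coordinates v j)
      residues j = trans (sym (finToFun-funToFin (residue p ∘ coordinates u) j))
        (trans (cong (λ l → finToFun {p} {k} l j) e) (finToFun-funToFin (residue p ∘ coordinates v) j))
      same : (λ i → + toℕ (u i)) C.≈ (λ i → + toℕ (v i))
      same = C.trans {λ i → + toℕ (u i)} {combination (coordinates u)} {λ i → + toℕ (v i)} (coordinates-determine u)
        (C.trans {combination (coordinates u)} {combination (coordinates v)} {λ i → + toℕ (v i)}
          (combination-cong {coordinates u} {coordinates v}
            (λ j → HasOrderProperties.to-injective (ℤ/ p) (hasOrder-ℤ/ p) {coordinates u j} {coordinates v j} (residues j)))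
          (C.sym {λ i → + toℕ (v i)} {combination (coordinates v)} (coordinates-determine v)))

-- Reduced Laplacians

restrict : ∀ {N} → Fin N → (Fin N → ℤ) → Fin (pred N) → ℤ
restrict {suc m} v x = removeAt x v

-- A vector on the remaining vertices is identified with its extension of total 0, so that the
-- choice of the deleted vertex no longer matters.
balance : ∀ {N} → Fin N → (Fin (pred N) → ℤ) → Fin N → ℤ
balance {suc m} v y = insertAt y v (ℤ.- ℤΣ.sum y)

insertAt-cong : ∀ {m} {x y : Fin m → ℤ} {a b} (v : Fin (suc m)) → (∀ i → x i ≡ y i) → a ≡ b →
  ∀ i → insertAt x v a i ≡ insertAt y v b i
insertAt-cong zero    x≗y a≡b zero    = a≡b
insertAt-cong zero    x≗y a≡b (suc i) = x≗y i
insertAt-cong {suc m} (suc v) x≗y a≡b zero    = x≗y zero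
insertAt-cong {suc m} (suc v) x≗y a≡b (suc i) = insertAt-cong v (x≗y ∘ suc) a≡b i

insertAt-+ : ∀ {m} (x y : Fin m → ℤ) a b (v : Fin (suc m)) i →
  insertAt (λ j → x j ℤ.+ y j) v (a ℤ.+ b) i ≡ insertAt x v a i ℤ.+ insertAt y v b i
insertAt-+ x y a b zero    zero    = refl
insertAt-+ x y a b zero    (suc i) = refl
insertAt-+ {suc m} x y a b (suc v) zero    = refl
insertAt-+ {suc m} x y a b (suc v) (suc i) = insertAt-+ (x ∘ suc) (y ∘ suc) a b v i

sum-insertAt : ∀ {m} (y : Fin m → ℤ) (v : Fin (suc m)) a →
  ℤΣ.sum (insertAt y v a) ≡ a ℤ.+ ℤΣ.sum y
sum-insertAt y v a = trans (ℤΣ.sum-remove {i = v} (insertAt y v a))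
  (cong₂ ℤ._+_ (insertAt-lookup y v a) (ℤΣ.sum-cong-≗ (insertAt-punchIn y v a)))

balance-cong : ∀ {N} (v : Fin N) {x y} → (∀ i → x i ≡ y i) → ∀ i → balance v x i ≡ balance v y i
balance-cong {suc m} v x≗y = insertAt-cong v x≗y (cong ℤ.-_ (ℤΣ.sum-cong-≗ x≗y))

balance-+ : ∀ {N} (v : Fin N) x y i →
  balance v (λ j → x j ℤ.+ y j) i ≡ balance v x i ℤ.+ balance v y i
balance-+ {suc m} v x y i = trans
  (insertAt-cong {x = λ j → x j ℤ.+ y j} v (λ _ → refl)
    (trans (cong ℤ.-_ (ℤΣ.∑-distrib-+ x y)) (ℤ.neg-distrib-+ (ℤΣ.sum x) (ℤΣ.sum y))) i)
  (insertAt-+ x y _ _ v i)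

sum-balance : ∀ {N} (v : Fin N) y → ℤΣ.sum (balance v y) ≡ 0ℤ
sum-balance {suc m} v y = trans (sum-insertAt y v _) (ℤ.+-inverseˡ (ℤΣ.sum y))

restrict-balance : ∀ {N} (v : Fin N) y i → restrict v (balance v y) i ≡ y i
restrict-balance {suc m} v y = insertAt-punchIn y v _

balance-restrict : ∀ {N} (v : Fin N) x → ℤΣ.sum x ≡ 0ℤ → ∀ i → balance v (restrict v x) i ≡ x i
balance-restrict {suc m} v x Σx≡0 i = trans
  (insertAt-cong {x = restrict v x} v (λ _ → refl) (sym x-v) i) (insertAt-removeAt x v i)
  where
  cancel : ∀ a b → a ≡ (a ℤ.+ b) ℤ.+ ℤ.- b
  cancel = solve-∀
  x-v : x v ≡ ℤ.- ℤΣ.sum (restrict v x)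
  x-v = begin
    x v                                                  ≡⟨ cancel (x v) (ℤΣ.sum (removeAt x v)) ⟩
    (x v ℤ.+ ℤΣ.sum (removeAt x v)) ℤ.+ ℤ.- ℤΣ.sum (removeAt x v)
      ≡⟨ cong (λ s → s ℤ.+ ℤ.- ℤΣ.sum (removeAt x v)) (trans (sym (ℤΣ.sum-remove {i = v} x)) Σx≡0) ⟩
    0ℤ ℤ.+ ℤ.- ℤΣ.sum (removeAt x v)                     ≡⟨ ℤ.+-identityˡ _ ⟩
    ℤ.- ℤΣ.sum (removeAt x v)                            ∎
    where open ≡-Reasoning

-- Extending z by 0 at v makes the deleted column contribute nothing.
deleteRowCol-*ᵥ : ∀ {N} (v : Fin N) (M : Matrix N) z → ∃ λ ẑ →
  ∀ i → restrict v (M *ᵥ ẑ) i ≡ (deleteRowCol v M *ᵥ z) i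
deleteRowCol-*ᵥ {suc m} v M z = insertAt z v 0ℤ , λ i → trans
  (ℤΣ.sum-remove {i = v} (λ j → M (punchIn v i) j ℤ.* insertAt z v 0ℤ j))
  (trans
    (cong₂ ℤ._+_
      (trans (cong (M (punchIn v i) v ℤ.*_) (insertAt-lookup z v 0ℤ)) (ℤ.*-zeroʳ (M (punchIn v i) v)))
      (ℤΣ.sum-cong-≗ (λ j → cong (M (punchIn v i) (punchIn v j) ℤ.*_) (insertAt-punchIn z v 0ℤ j))))
    (ℤ.+-identityˡ _))

-- Since constants lie in the kernel of `M`, the value z v may be subtracted from z everywhere. The
-- shifted vector vanishes at v, so it is determined by its restriction.
*ᵥ-deleteRowCol : ∀ {N} (v : Fin N) (M : Matrix N) →
  (∀ z c i → (M *ᵥ (λ j → z j ℤ.+ c)) i ≡ (M *ᵥ z) i) →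
  ∀ z → ∃ λ z′ → ∀ i → (deleteRowCol v M *ᵥ z′) i ≡ restrict v (M *ᵥ z) i
*ᵥ-deleteRowCol {suc m} v M M-const z = (λ j → z (punchIn v j) ℤ.- z v) , λ i → trans
  (sym (trans
    (ℤΣ.sum-remove {i = v} (λ j → M (punchIn v i) j ℤ.* (z j ℤ.- z v)))
    (trans
      (cong (λ s → s ℤ.+ (deleteRowCol v M *ᵥ (λ j → z (punchIn v j) ℤ.- z v)) i)
        (trans (cong (M (punchIn v i) v ℤ.*_) (ℤ.+-inverseʳ (z v))) (ℤ.*-zeroʳ (M (punchIn v i) v))))
      (ℤ.+-identityˡ _))))
  (M-const z (ℤ.- z v) (punchIn v i))

module _ {N} (M : Matrix N) (v : Fin N)
  (sum-M : ∀ z → ℤΣ.sum (M *ᵥ z) ≡ 0ℤ)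
  (M-const : ∀ z c i → (M *ᵥ (λ j → z j ℤ.+ c)) i ≡ (M *ᵥ z) i)
  (B : Ab)
  where
  private
    module B = AbelianGroup B
    module MB = Multiples B
    open MB using () renaming (_·_ to _·ᴮ_)
    J = cokernel (deleteRowCol v M)
    module J = AbelianGroup J
    module MJ = Multiples J

  ·-pointwise : ∀ n y i → (n MJ.· y) i ≡ + n ℤ.* y i
  ·-pointwise zero    y i = sym (ℤ.*-zeroˡ (y i))
  ·-pointwise (suc n) y i = trans (cong (λ s → y i ℤ.+ s) (·-pointwise n y i)) (sym (ℤ.suc-* (+ n) (y i)))

  -- When the image of `M` has total 0 and constants are in its kernel, the reduced cokernel is the
  -- group of vectors of total 0 modulo the image of `M`. This lets φ be built on full vectors,
  -- where the deck group acts, while the Jacobian itself is defined by deleting a vertex.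
  sylow-reduced-cokernel :
    ∀ {p e c c′} → Prime p → p ∤ c → p ∤ c′ →
    (φ : (Fin N → ℤ) → B.Carrier) →
    (∀ {x y} → (∀ i → x i ≡ y i) → φ x B.≈ φ y) →
    (∀ x y → φ (λ i → x i ℤ.+ y i) B.≈ φ x B.∙ φ y) →
    (∀ z → φ (M *ᵥ z) B.≈ B.ε) →
    (∀ x → ℤΣ.sum x ≡ 0ℤ → φ x B.≈ B.ε → ∃ λ z → ∀ i → + c ℤ.* x i ≡ (M *ᵥ z) i) →
    (∀ b → ∃ λ x → ℤΣ.sum x ≡ 0ℤ × φ x B.≈ c′ ·ᴮ b) →
    (∀ b → (p ^ e) ·ᴮ b B.≈ B.ε) →
    Sylow p J ≅ B
  sylow-reduced-cokernel {p} {e} {c} {c′} p-prime p∤c p∤c′ φ φ-cong φ-homo relations kernel image exponent =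
    sylow-≅ J B {p} {e} {c} {c′} p-prime p∤c p∤c′ ψ (λ {x} {y} → ψ-cong {x} {y}) ψ-homo ψ-kernel ψ-image exponent
    where
    open import Relation.Binary.Reasoning.Setoid B.setoid

    ψ : J.Carrier → B.Carrier
    ψ y = φ (balance v y)

    ψ-homo : ∀ x y → ψ (λ i → x i ℤ.+ y i) B.≈ ψ x B.∙ ψ y
    ψ-homo x y = B.trans (φ-cong (balance-+ v x y)) (φ-homo (balance v x) (balance v y))

    cancel : ∀ a b → a ≡ (a ℤ.- b) ℤ.+ b
    cancel = solve-∀

    ψ-relations : ∀ {y} → (∃ λ z → ∀ i → y i ≡ (deleteRowCol v M *ᵥ z) i) → ψ y B.≈ B.ε
    ψ-relations {y} (z , e) with deleteRowCol-*ᵥ v M z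
    ... | ẑ , f = B.trans
      (φ-cong (λ i → trans (balance-cong v (λ j → trans (e j) (sym (f j))) i)
        (balance-restrict v (M *ᵥ ẑ) (sum-M ẑ) i)))
      (relations ẑ)

    ψ-cong : ∀ {x y} → x J.≈ y → ψ x B.≈ ψ y
    ψ-cong {x} {y} x≈y = begin
      -- Equality in `J` is membership of x - y in the image, so x is rewritten as (x - y) + y.
      ψ x                                    ≈⟨ φ-cong (balance-cong v (λ i → cancel (x i) (y i))) ⟩
      ψ (λ i → (x i ℤ.- y i) ℤ.+ y i)        ≈⟨ ψ-homo (λ i → x i ℤ.- y i) y ⟩
      ψ (λ i → x i ℤ.- y i) B.∙ ψ y          ≈⟨ B.∙-congʳ (ψ-relations x≈y) ⟩
      B.ε B.∙ ψ y                            ≈⟨ B.identityˡ (ψ y) ⟩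
      ψ y                                    ∎

    ψ-kernel : ∀ y → ψ y B.≈ B.ε → (c MJ.· y) J.≈ J.ε
    ψ-kernel y ψy≈ε with kernel (balance v y) (sum-balance v y) ψy≈ε
    ... | z , e with *ᵥ-deleteRowCol v M M-const z
    ... | z′ , f = z′ , λ i → trans (ℤ.+-identityʳ _) (trans (·-pointwise c y i)
      (trans (multiple v y e i) (sym (f i))))
      where
      multiple : ∀ {N} (v : Fin N) y {w} → (∀ i → + c ℤ.* balance v y i ≡ w i) →
        ∀ i → + c ℤ.* y i ≡ restrict v w i
      multiple {suc m} v y e i =
        trans (cong (+ c ℤ.*_) (sym (restrict-balance v y i))) (e (punchIn v i))

    ψ-image : ∀ b → ∃ λ y → ψ y B.≈ c′ ·ᴮ b
    ψ-image b with image b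
    ... | x , Σx≡0 , φx≈c′b = restrict v x , B.trans (φ-cong (balance-restrict v x Σx≡0)) φx≈c′b

-- The Laplacian of the cover

sum-↑ : ∀ m {n} (f : Fin (m + n) → ℤ) →
  ℤΣ.sum f ≡ ℤΣ.sum (λ i → f (i ↑ˡ n)) ℤ.+ ℤΣ.sum (λ j → f (m ↑ʳ j))
sum-↑ zero    f = sym (ℤ.+-identityˡ _)
sum-↑ (suc m) f = trans (cong (λ s → f zero ℤ.+ s) (sum-↑ m (f ∘ suc))) (sym (ℤ.+-assoc (f zero) _ _))

sum-combine : ∀ m {n} (f : Fin (m * n) → ℤ) →
  ℤΣ.sum f ≡ ℤΣ.sum (λ i → ℤΣ.sum (λ j → f (combine {m} {n} i j)))
sum-combine zero    f = refl
sum-combine (suc m) {n} f = trans (sum-↑ n f)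
  (cong (λ s → ℤΣ.sum (λ j → f (j ↑ˡ (m * n))) ℤ.+ s) (sum-combine m (λ k → f (n ↑ʳ k))))

sum-blocks : ∀ m {n} (f : Fin (m * n) → ℤ) (g : Fin m → ℤ) →
  (∀ i → ℤΣ.sum (λ j → f (combine {m} {n} i j)) ≡ g i) → ℤΣ.sum f ≡ ℤΣ.sum g
sum-blocks m f g blocks = trans (sum-combine m f) (ℤΣ.sum-cong-≗ blocks)

indicator-≟ : ∀ {k} (i j : Fin k) z → (if does (i Fin.≟ j) then z else 0ℤ) ≡ single i z j
indicator-≟ zero    zero    z = refl
indicator-≟ zero    (suc j) z = refl
indicator-≟ (suc i) zero    z = refl
indicator-≟ (suc i) (suc j) z = indicator-≟ i j z

indicator-∧ : ∀ b c → (if b ∧ c then 1ℤ else 0ℤ) ≡ (if b then 1ℤ else 0ℤ) ℤ.* (if c then 1ℤ else 0ℤ)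
indicator-∧ true  true  = refl
indicator-∧ true  false = refl
indicator-∧ false c     = sym (ℤ.*-zeroˡ (if c then 1ℤ else 0ℤ))

-- Parity takes the integer values 0 and 1, so that bipartite adjacency becomes a polynomial in the
-- parities of the endpoints and sums over a class become weighted sums over all vertices.
isEven : ℕ → ℤ
isEven zero    = 1ℤ
isEven (suc k) = 1ℤ ℤ.- isEven k

private
  double-complement : ∀ x → x ≡ 1ℤ ℤ.- (1ℤ ℤ.- x)
  double-complement = solve-∀

isEven-cases : ∀ k → isEven k ≡ 1ℤ ⊎ isEven k ≡ 0ℤ
isEven-cases zero = inj₁ refl
isEven-cases (suc k) with isEven-cases k
... | inj₁ e = inj₂ (cong (λ x → 1ℤ ℤ.- x) e)
... | inj₂ e = inj₁ (cong (λ x → 1ℤ ℤ.- x) e)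

isEven-+ : ∀ a b → isEven (a + b) ≡
  isEven a ℤ.* isEven b ℤ.+ (1ℤ ℤ.- isEven a) ℤ.* (1ℤ ℤ.- isEven b)
isEven-+ zero    b = base (isEven b)
  where
  base : ∀ x → x ≡ 1ℤ ℤ.* x ℤ.+ (1ℤ ℤ.- 1ℤ) ℤ.* (1ℤ ℤ.- x)
  base = solve-∀
isEven-+ (suc a) b = trans (cong (λ x → 1ℤ ℤ.- x) (isEven-+ a b)) (step (isEven a) (isEven b))
  where
  step : ∀ x y → 1ℤ ℤ.- (x ℤ.* y ℤ.+ (1ℤ ℤ.- x) ℤ.* (1ℤ ℤ.- y)) ≡
    (1ℤ ℤ.- x) ℤ.* y ℤ.+ (1ℤ ℤ.- (1ℤ ℤ.- x)) ℤ.* (1ℤ ℤ.- y)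
  step = solve-∀

indicator-odd : ∀ k → (if does (¬? (2 ∣? k)) then 1ℤ else 0ℤ) ≡ 1ℤ ℤ.- isEven k
indicator-odd zero = refl
indicator-odd (suc zero) = refl
indicator-odd (suc (suc k)) = trans
  (cong (λ b → if b then 1ℤ else 0ℤ) (does-⇔
    (mk⇔ (contraposition (∣m∣n⇒∣m+n ∣-refl)) (contraposition (λ 2∣k → ∣m+n∣m⇒∣n 2∣k ∣-refl)))
    (¬? (2 ∣? suc (suc k))) (¬? (2 ∣? k))))
  (trans (indicator-odd k) (cong (λ x → 1ℤ ℤ.- x) (double-complement (isEven k))))

-- The indicator of the class v₁, v₃, … of the bipartition.
χ : ∀ {m} → Fin m → ℤ
χ i = isEven (toℕ i)

-- The product n * 2 unfolds by two at each step, exposing one vertex of each class.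
sum-χ : ∀ {m} n → m ≡ n * 2 → ℤΣ.sum {m} χ ≡ + n
sum-χ zero    refl = refl
sum-χ (suc n) refl = begin
  1ℤ ℤ.+ (0ℤ ℤ.+ ℤΣ.sum {n * 2} (λ i → 1ℤ ℤ.- (1ℤ ℤ.- χ i)))
    ≡⟨ cong (λ x → 1ℤ ℤ.+ x) (ℤ.+-identityˡ (ℤΣ.sum {n * 2} (λ i → 1ℤ ℤ.- (1ℤ ℤ.- χ i)))) ⟩
  1ℤ ℤ.+ ℤΣ.sum {n * 2} (λ i → 1ℤ ℤ.- (1ℤ ℤ.- χ i))
    ≡⟨ cong (λ x → 1ℤ ℤ.+ x) (ℤΣ.sum-cong-≗ {n * 2} (λ i → double-complement (χ i))) ⟨
  1ℤ ℤ.+ ℤΣ.sum {n * 2} χ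
    ≡⟨ cong (λ x → 1ℤ ℤ.+ x) (sum-χ {n * 2} n refl) ⟩
  1ℤ ℤ.+ + n ∎
  where open ≡-Reasoning

indicator-edge : ∀ {m} (i j : Fin m) →
  (if does (¬? (2 ∣? (label i + label j))) then 1ℤ else 0ℤ) ≡
  χ i ℤ.* (1ℤ ℤ.- χ j) ℤ.+ (1ℤ ℤ.- χ i) ℤ.* χ j
indicator-edge i j = trans (indicator-odd (label i + label j))
  (trans (cong (λ x → 1ℤ ℤ.- x) (isEven-+ (label i) (label j))) (expand (χ i) (χ j)))
  where
  expand : ∀ x y →
    1ℤ ℤ.- ((1ℤ ℤ.- x) ℤ.* (1ℤ ℤ.- y) ℤ.+ (1ℤ ℤ.- (1ℤ ℤ.- x)) ℤ.* (1ℤ ℤ.- (1ℤ ℤ.- y))) ≡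
    x ℤ.* (1ℤ ℤ.- y) ℤ.+ (1ℤ ℤ.- x) ℤ.* y
  expand = solve-∀

-- Rotation of the fibres and partial sums

module _ {d : ℕ} .{{_ : NonZero d}} where
  rotate : ℤ → Fin d → Fin d
  rotate a g = residue d (+ toℕ g ℤ.+ a)

  rotate-unique : ∀ a g h → + d ℤ∣.∣ + toℕ h ℤ.- (+ toℕ g ℤ.+ a) → rotate a g ≡ h
  rotate-unique a g h d∣ = sym (toℕ-unique h (rotate a g)
    (subst (+ d ℤ∣.∣_) (telescope (+ toℕ h) (+ toℕ g ℤ.+ a) (+ toℕ (rotate a g)))
      (ℤ∣.∣m∣n⇒∣m+n d∣ (residue-∣ d (+ toℕ g ℤ.+ a)))))
    where
    telescope : ∀ x y z → (x ℤ.- y) ℤ.+ (y ℤ.- z) ≡ x ℤ.- z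
    telescope = solve-∀

  rotate-∣ : ∀ a g → + d ℤ∣.∣ + toℕ (rotate a g) ℤ.- (+ toℕ g ℤ.+ a)
  rotate-∣ a g = subst (+ d ℤ∣.∣_) (negate (+ toℕ g ℤ.+ a) (+ toℕ (rotate a g)))
    (ℤ∣.∣m⇒∣-m (residue-∣ d (+ toℕ g ℤ.+ a)))
    where
    negate : ∀ x y → ℤ.- (x ℤ.- y) ≡ y ℤ.- x
    negate = solve-∀

  rotate-0 : ∀ g → rotate 0ℤ g ≡ g
  rotate-0 g = rotate-unique 0ℤ g g (ℤ∣.divides 0ℤ (cancel (+ toℕ g)))
    where
    cancel : ∀ x → x ℤ.- (x ℤ.+ 0ℤ) ≡ 0ℤ ℤ.* + d
    cancel x = trans (cong (λ s → x ℤ.- s) (ℤ.+-identityʳ x)) (ℤ.+-inverseʳ x)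

  rotate-inverse : ∀ a g → rotate (ℤ.- a) (rotate a g) ≡ g
  rotate-inverse a g = rotate-unique (ℤ.- a) (rotate a g) g
    (subst (+ d ℤ∣.∣_) (negate (+ toℕ g) (+ toℕ (rotate a g)) a) (ℤ∣.∣m⇒∣-m (rotate-∣ a g)))
    where
    negate : ∀ x y a → ℤ.- (y ℤ.- (x ℤ.+ a)) ≡ x ℤ.- (y ℤ.+ ℤ.- a)
    negate = solve-∀

  sum-rotate : ∀ (f : Fin d → ℤ) → ℤΣ.sum (λ g → f (rotate 1ℤ g)) ≡ ℤΣ.sum f
  sum-rotate f = sym (ℤΣ.sum-permute f
    (permutation (rotate 1ℤ) (rotate -1ℤ) (rotate-inverse -1ℤ) (rotate-inverse 1ℤ)))

  sum-rotate⁻¹ : ∀ (f : Fin d → ℤ) → ℤΣ.sum (λ g → f (rotate -1ℤ g)) ≡ ℤΣ.sum f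
  sum-rotate⁻¹ f = sym (ℤΣ.sum-permute f
    (permutation (rotate -1ℤ) (rotate 1ℤ) (rotate-inverse 1ℤ) (rotate-inverse -1ℤ)))

  indicator-rotate : ∀ a g h →
    (if does (+ d ℤ∣.∣? (+ toℕ h ℤ.- (+ toℕ g ℤ.+ a))) then 1ℤ else 0ℤ) ≡ single (rotate a g) 1ℤ h
  indicator-rotate a g h = trans
    (cong (λ b → if b then 1ℤ else 0ℤ) (does-⇔
      (mk⇔ (rotate-unique a g h)
        (λ e → subst (λ k → + d ℤ∣.∣ + toℕ k ℤ.- (+ toℕ g ℤ.+ a)) e (rotate-∣ a g)))
      (+ d ℤ∣.∣? (+ toℕ h ℤ.- (+ toℕ g ℤ.+ a))) (rotate a g Fin.≟ h)))
    (indicator-≟ (rotate a g) h 1ℤ)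

rotate⁻¹-zero : ∀ {d} → rotate {suc d} -1ℤ zero ≡ fromℕ d
rotate⁻¹-zero {d} = rotate-unique -1ℤ zero (fromℕ d)
  (ℤ∣.divides 1ℤ (trans (cong (λ k → + k ℤ.- (0ℤ ℤ.+ -1ℤ)) (toℕ-fromℕ d)) (shift (+ d))))
  where
  shift : ∀ x → x ℤ.- (0ℤ ℤ.+ -1ℤ) ≡ 1ℤ ℤ.* (1ℤ ℤ.+ x)
  shift = solve-∀

rotate⁻¹-suc : ∀ {d} (g : Fin d) → rotate {suc d} -1ℤ (suc g) ≡ inject₁ g
rotate⁻¹-suc {d} g = rotate-unique -1ℤ (suc g) (inject₁ g)
  (ℤ∣.divides 0ℤ (trans (cong (λ k → + k ℤ.- (+ suc (toℕ g) ℤ.+ -1ℤ)) (toℕ-inject₁ g)) (shift (+ toℕ g))))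
  where
  shift : ∀ x → x ℤ.- (1ℤ ℤ.+ x ℤ.+ -1ℤ) ≡ 0ℤ
  shift = solve-∀

prefixSum : ∀ {d} → (Fin d → ℤ) → Fin d → ℤ
prefixSum f zero    = f zero
prefixSum f (suc g) = f zero ℤ.+ prefixSum (f ∘ suc) g

prefixSum-suc : ∀ {d} (f : Fin (suc d) → ℤ) g →
  prefixSum f (suc g) ≡ prefixSum f (inject₁ g) ℤ.+ f (suc g)
prefixSum-suc f zero    = refl
prefixSum-suc f (suc g) = trans
  (cong (λ s → f zero ℤ.+ s) (prefixSum-suc (f ∘ suc) g)) (sym (ℤ.+-assoc (f zero) _ _))

prefixSum-last : ∀ {d} (f : Fin (suc d) → ℤ) → prefixSum f (fromℕ d) ≡ ℤΣ.sum f
prefixSum-last {zero}  f = sym (ℤ.+-identityʳ (f zero))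
prefixSum-last {suc d} f = cong (λ s → f zero ℤ.+ s) (prefixSum-last (f ∘ suc))

prefixSum-cong : ∀ {d} {f g : Fin d → ℤ} → (∀ i → f i ≡ g i) → ∀ i → prefixSum f i ≡ prefixSum g i
prefixSum-cong f≗g zero    = f≗g zero
prefixSum-cong f≗g (suc i) = cong₂ ℤ._+_ (f≗g zero) (prefixSum-cong (f≗g ∘ suc) i)

prefixSum-+ : ∀ {d} (f g : Fin d → ℤ) i →
  prefixSum (λ j → f j ℤ.+ g j) i ≡ prefixSum f i ℤ.+ prefixSum g i
prefixSum-+ f g zero    = refl
prefixSum-+ f g (suc i) = trans
  (cong (λ s → f zero ℤ.+ g zero ℤ.+ s) (prefixSum-+ (f ∘ suc) (g ∘ suc) i))
  (interchange (f zero) (g zero) _ _)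
  where
  interchange : ∀ a b c d → (a ℤ.+ b) ℤ.+ (c ℤ.+ d) ≡ (a ℤ.+ c) ℤ.+ (b ℤ.+ d)
  interchange = solve-∀

-- Only the wrap-around at `zero` needs the total: its predecessor is the last index, whose partial
-- sum is the full sum 0.
prefixSum-rotate : ∀ {d} (f : Fin (suc d) → ℤ) → ℤΣ.sum f ≡ 0ℤ →
  ∀ g → prefixSum f g ≡ prefixSum f (rotate -1ℤ g) ℤ.+ f g
prefixSum-rotate f Σf≡0 zero = sym (trans
  (cong (ℤ._+ f zero) (trans (cong (prefixSum f) rotate⁻¹-zero) (trans (prefixSum-last f) Σf≡0)))
  (ℤ.+-identityˡ (f zero)))
prefixSum-rotate f Σf≡0 (suc g) = trans (prefixSum-suc f g)
  (cong (λ h → prefixSum f h ℤ.+ f (suc g)) (sym (rotate⁻¹-suc g)))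

-- This is the kernel of τ - 1, and it is what makes antidifferences unique up to a constant.
rotation-invariant⇒constant : ∀ {d} (f : Fin (suc d) → ℤ) → (∀ g → f (rotate -1ℤ g) ≡ f g) →
  ∀ g → f g ≡ f zero
rotation-invariant⇒constant {d} f invariant =
  constant f (λ g → trans (sym (invariant (suc g))) (cong f (rotate⁻¹-suc g)))
  where
  constant : ∀ {d} (f : Fin (suc d) → ℤ) → (∀ g → f (suc g) ≡ f (inject₁ g)) → ∀ g → f g ≡ f zero
  constant f step zero = refl
  constant {suc d} f step (suc g) = trans (constant (f ∘ suc) (step ∘ suc) g) (step zero)

sum-distribˡ-* : ∀ {k} a (f : Fin k → ℤ) → ℤΣ.sum (λ i → a ℤ.* f i) ≡ a ℤ.* ℤΣ.sum f
sum-distribˡ-* a f = sym (ℤΣ.*-distribˡ-sum a f)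

sum-ones : ∀ k → ℤΣ.sum {k} (λ _ → 1ℤ) ≡ + k
sum-ones zero    = refl
sum-ones (suc k) = cong (λ s → 1ℤ ℤ.+ s) (sum-ones k)

χ-idempotent : ∀ {m} (i : Fin m) → χ i ℤ.* χ i ≡ χ i
χ-idempotent i with isEven-cases (toℕ i)
... | inj₁ e = trans (cong₂ ℤ._*_ e e) (sym e)
... | inj₂ e = trans (cong₂ ℤ._*_ e e) (sym e)

-- Rows of the Laplacian in terms of the two class sums

module Cover (n′ d′ : ℕ) where
  private
    n d : ℕ
    n = suc (suc n′)
    d = suc d′
    Y = singleVoltageCover n d
    N = + n
  open Graph Y using (vertex; _~?_; adjacency; laplacian)

  V = Fin (2 * n)

  v₁ v₂ : V
  v₁ = zero
  v₂ = suc zero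

  infix 9 _at_
  _at_ : V → Fin d → Fin (2 * n * d)
  _at_ = combine {2 * n} {d}

  sumA sumB : (V → ℤ) → ℤ
  sumA y = ℤΣ.sum (λ i → χ i ℤ.* y i)
  sumB y = ℤΣ.sum (λ i → (1ℤ ℤ.- χ i) ℤ.* y i)

  classA classB : (V → Fin d → ℤ) → Fin d → ℤ
  classA z g = sumA (λ i → z i g)
  classB z g = sumB (λ i → z i g)

  ends : ℤ → ℤ → V → ℤ
  ends s t zero          = s
  ends s t (suc zero)    = t
  ends s t (suc (suc i)) = 0ℤ

  -- The correction to d disjoint copies of K_{n,n}: only the edge v₁v₂ has a nontrivial voltage, so
  -- v₁ in sheet g sees v₂ in sheet g + 1, and v₂ in sheet g sees v₁ in sheet g - 1.
  twist : (V → Fin d → ℤ) → V → Fin d → ℤ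
  twist z i g = ends (z v₂ (rotate 1ℤ g) ℤ.- z v₂ g) (z v₁ (rotate -1ℤ g) ℤ.- z v₁ g) i

  neighbours : (V → Fin d → ℤ) → V → Fin d → ℤ
  neighbours z i g = χ i ℤ.* classB z g ℤ.+ (1ℤ ℤ.- χ i) ℤ.* classA z g ℤ.+ twist z i g

  edge : V → V → ℤ
  edge i j = χ i ℤ.* (1ℤ ℤ.- χ j) ℤ.+ (1ℤ ℤ.- χ i) ℤ.* χ j

  voltage : V → V → ℤ
  voltage i j = singleVoltage (label i) (label j)

  sum-edge : ∀ i (f : V → ℤ) → ℤΣ.sum (λ j → edge i j ℤ.* f j) ≡
    χ i ℤ.* ℤΣ.sum (λ j → (1ℤ ℤ.- χ j) ℤ.* f j) ℤ.+ (1ℤ ℤ.- χ i) ℤ.* ℤΣ.sum (λ j → χ j ℤ.* f j)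
  sum-edge i f = trans
    (trans (ℤΣ.sum-cong-≗ (λ j → expand (χ i) (χ j) (f j)))
      (ℤΣ.∑-distrib-+ (λ j → χ i ℤ.* ((1ℤ ℤ.- χ j) ℤ.* f j)) (λ j → (1ℤ ℤ.- χ i) ℤ.* (χ j ℤ.* f j))))
    (sym (cong₂ ℤ._+_
      (ℤΣ.*-distribˡ-sum (χ i) (λ j → (1ℤ ℤ.- χ j) ℤ.* f j))
      (ℤΣ.*-distribˡ-sum (1ℤ ℤ.- χ i) (λ j → χ j ℤ.* f j))))
    where
    expand : ∀ x y z → (x ℤ.* (1ℤ ℤ.- y) ℤ.+ (1ℤ ℤ.- x) ℤ.* y) ℤ.* z ≡
      x ℤ.* ((1ℤ ℤ.- y) ℤ.* z) ℤ.+ (1ℤ ℤ.- x) ℤ.* (y ℤ.* z)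
    expand = solve-∀

  sum-twisted : ∀ z i g →
    ℤΣ.sum (λ j → edge i j ℤ.* z j (rotate (voltage i j) g)) ≡
    ℤΣ.sum (λ j → edge i j ℤ.* z j g) ℤ.+ twist z i g
  sum-twisted z zero g = begin
    0ℤ ℤ.* u₀ ℤ.+ (1ℤ ℤ.* u₁ ℤ.+ s)
      ≡⟨ cong₂ (λ a b → 0ℤ ℤ.* z zero a ℤ.+ (1ℤ ℤ.* u₁ ℤ.+ b)) (rotate-0 g)
           (ℤΣ.sum-cong-≗ (λ j → cong (λ a → edge zero (suc (suc j)) ℤ.* z (suc (suc j)) a) (rotate-0 g))) ⟩
    0ℤ ℤ.* z zero g ℤ.+ (1ℤ ℤ.* u₁ ℤ.+ s′)
      ≡⟨ move (0ℤ ℤ.* z zero g) u₁ (z (suc zero) g) s′ ⟩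
    0ℤ ℤ.* z zero g ℤ.+ (1ℤ ℤ.* z (suc zero) g ℤ.+ s′) ℤ.+ (u₁ ℤ.- z (suc zero) g) ∎
    where
    open ≡-Reasoning
    u₀ = z zero (rotate 0ℤ g)
    u₁ = z (suc zero) (rotate 1ℤ g)
    s  = ℤΣ.sum (λ j → edge zero (suc (suc j)) ℤ.* z (suc (suc j)) (rotate 0ℤ g))
    s′ = ℤΣ.sum (λ j → edge zero (suc (suc j)) ℤ.* z (suc (suc j)) g)
    move : ∀ a b c s → a ℤ.+ (1ℤ ℤ.* b ℤ.+ s) ≡ a ℤ.+ (1ℤ ℤ.* c ℤ.+ s) ℤ.+ (b ℤ.- c)
    move = solve-∀
  sum-twisted z (suc zero) g = begin
    1ℤ ℤ.* u₀ ℤ.+ (0ℤ ℤ.* u₁ ℤ.+ s)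
      ≡⟨ cong₂ (λ a b → 1ℤ ℤ.* u₀ ℤ.+ (0ℤ ℤ.* z (suc zero) a ℤ.+ b)) (rotate-0 g)
           (ℤΣ.sum-cong-≗ (λ j → cong (λ a → edge (suc zero) (suc (suc j)) ℤ.* z (suc (suc j)) a) (rotate-0 g))) ⟩
    1ℤ ℤ.* u₀ ℤ.+ (0ℤ ℤ.* z (suc zero) g ℤ.+ s′)
      ≡⟨ move u₀ (z zero g) (0ℤ ℤ.* z (suc zero) g ℤ.+ s′) ⟩
    1ℤ ℤ.* z zero g ℤ.+ (0ℤ ℤ.* z (suc zero) g ℤ.+ s′) ℤ.+ (u₀ ℤ.- z zero g) ∎
    where
    open ≡-Reasoning
    u₀ = z zero (rotate -1ℤ g)
    u₁ = z (suc zero) (rotate 0ℤ g)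
    s  = ℤΣ.sum (λ j → edge (suc zero) (suc (suc j)) ℤ.* z (suc (suc j)) (rotate 0ℤ g))
    s′ = ℤΣ.sum (λ j → edge (suc zero) (suc (suc j)) ℤ.* z (suc (suc j)) g)
    move : ∀ b c s → 1ℤ ℤ.* b ℤ.+ s ≡ 1ℤ ℤ.* c ℤ.+ s ℤ.+ (b ℤ.- c)
    move = solve-∀
  sum-twisted z (suc (suc i)) g = trans
    (ℤΣ.sum-cong-≗ (λ j → cong (λ a → edge (suc (suc i)) j ℤ.* z j a) (rotate-0 g)))
    (sym (ℤ.+-identityʳ _))

  vertex-at : ∀ i g → vertex (i at g) ≡ (i , g)
  vertex-at = remQuot-combine {2 * n} {d}

  adjacency-combine : ∀ i g j h → adjacency (i at g) (j at h) ≡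
    edge i j ℤ.* single (rotate (voltage i j) g) 1ℤ h
  adjacency-combine i g j h = trans
    (cong₂ (λ x y → if does (x ~? y) then 1ℤ else 0ℤ) (vertex-at i g) (vertex-at j h)) (trans
    (indicator-∧ (does (¬? (2 ∣? (label i + label j))))
      (does (+ d ℤ∣.∣? (+ toℕ h ℤ.- (+ toℕ g ℤ.+ voltage i j)))))
    (cong₂ ℤ._*_ (indicator-edge i j) (indicator-rotate (voltage i j) g h)))

  -- A vertex has at most one neighbour in each fibre, so the sum over the fibre of j collapses to
  -- the value at the rotated index.
  sum-adjacency : ∀ (z : Fin (2 * n * d) → ℤ) i g →
    ℤΣ.sum (λ k → adjacency (i at g) k ℤ.* z k) ≡ neighbours (λ j h → z (j at h)) i g
  sum-adjacency z i g = trans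
    (sum-blocks (2 * n) {d} (λ k → adjacency (i at g) k ℤ.* z k)
      (λ j → edge i j ℤ.* z′ j (rotate (voltage i j) g)) inner)
    (trans (sum-twisted z′ i g) (cong (ℤ._+ twist z′ i g) (sum-edge i (λ j → z′ j g))))
    where
    open ≡-Reasoning
    z′ : V → Fin d → ℤ
    z′ j h = z (j at h)
    inner : ∀ j → ℤΣ.sum (λ h → adjacency (i at g) (j at h) ℤ.* z′ j h) ≡
      edge i j ℤ.* z′ j (rotate (voltage i j) g)
    inner j = begin
      ℤΣ.sum (λ h → adjacency (i at g) (j at h) ℤ.* z′ j h)
        ≡⟨ ℤΣ.sum-cong-≗ {d} (λ h → trans (cong (ℤ._* z′ j h) (adjacency-combine i g j h))
             (ℤ.*-assoc (edge i j) (single r 1ℤ h) (z′ j h))) ⟩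
      ℤΣ.sum (λ h → edge i j ℤ.* (single r 1ℤ h ℤ.* z′ j h))
        ≡⟨ ℤΣ.*-distribˡ-sum (edge i j) (λ h → single r 1ℤ h ℤ.* z′ j h) ⟨
      edge i j ℤ.* ℤΣ.sum (λ h → single r 1ℤ h ℤ.* z′ j h)
        ≡⟨ cong (edge i j ℤ.*_) (trans (sum-single r 1ℤ (z′ j)) (ℤ.*-identityˡ _)) ⟩
      edge i j ℤ.* z′ j r ∎
      where
      r = rotate (voltage i j) g

  -- A multiple of y, plus a constant on each class, plus a correction at v₁ and v₂. Rows of the
  -- Laplacian, the constant function 1 and the solution of the linear system all have this shape,
  -- so one computation of class sums serves them all.
  affine : ℤ → (V → ℤ) → ℤ → ℤ → ℤ → ℤ → V → ℤ
  affine a y b c s t i = a ℤ.* y i ℤ.+ (χ i ℤ.* b ℤ.+ (1ℤ ℤ.- χ i) ℤ.* c) ℤ.+ ends s t i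

  sumV-χ : ℤΣ.sum {2 * n} χ ≡ N
  sumV-χ = sum-χ {2 * n} n (ℕ.*-comm 2 n)

  sumA+sumB : ∀ y → sumA y ℤ.+ sumB y ≡ ℤΣ.sum y
  sumA+sumB y = trans (sym (ℤΣ.∑-distrib-+ (λ i → χ i ℤ.* y i) (λ i → (1ℤ ℤ.- χ i) ℤ.* y i)))
    (ℤΣ.sum-cong-≗ (λ i → split (χ i) (y i)))
    where
    split : ∀ x y → x ℤ.* y ℤ.+ (1ℤ ℤ.- x) ℤ.* y ≡ y
    split = solve-∀

  sum-affine : ∀ a y b c s t → ℤΣ.sum (affine a y b c s t) ≡
    a ℤ.* ℤΣ.sum y ℤ.+ (N ℤ.* b ℤ.+ N ℤ.* c) ℤ.+ (s ℤ.+ t)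
  sum-affine a y b c s t = begin
    ℤΣ.sum (affine a y b c s t)
      ≡⟨ ℤΣ.∑-distrib-+ (λ i → a ℤ.* y i ℤ.+ (χ i ℤ.* b ℤ.+ (1ℤ ℤ.- χ i) ℤ.* c)) (ends s t) ⟩
    ℤΣ.sum (λ i → a ℤ.* y i ℤ.+ (χ i ℤ.* b ℤ.+ (1ℤ ℤ.- χ i) ℤ.* c)) ℤ.+ ℤΣ.sum (ends s t)
      ≡⟨ cong₂ ℤ._+_
           (trans (ℤΣ.∑-distrib-+ (λ i → a ℤ.* y i) (λ i → χ i ℤ.* b ℤ.+ (1ℤ ℤ.- χ i) ℤ.* c))
             (cong₂ ℤ._+_ (sum-distribˡ-* a y) classes))
           (cong (λ r → s ℤ.+ (t ℤ.+ r)) (sum-zero {n′ + suc (suc (n′ + 0))} (λ _ → refl))) ⟩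
    a ℤ.* ℤΣ.sum y ℤ.+ (N ℤ.* b ℤ.+ N ℤ.* c) ℤ.+ (s ℤ.+ (t ℤ.+ 0ℤ))
      ≡⟨ cong (λ r → a ℤ.* ℤΣ.sum y ℤ.+ (N ℤ.* b ℤ.+ N ℤ.* c) ℤ.+ (s ℤ.+ r)) (ℤ.+-identityʳ t) ⟩
    a ℤ.* ℤΣ.sum y ℤ.+ (N ℤ.* b ℤ.+ N ℤ.* c) ℤ.+ (s ℤ.+ t) ∎
    where
    open ≡-Reasoning
    regroup : ∀ x b c → x ℤ.* b ℤ.+ (1ℤ ℤ.- x) ℤ.* c ≡ (b ℤ.- c) ℤ.* x ℤ.+ c ℤ.* 1ℤ
    regroup = solve-∀
    collect : ∀ b c k → (b ℤ.- c) ℤ.* k ℤ.+ c ℤ.* (k ℤ.+ k) ≡ k ℤ.* b ℤ.+ k ℤ.* c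
    collect = solve-∀
    classes : ℤΣ.sum {2 * n} (λ i → χ i ℤ.* b ℤ.+ (1ℤ ℤ.- χ i) ℤ.* c) ≡ N ℤ.* b ℤ.+ N ℤ.* c
    classes = begin
      ℤΣ.sum {2 * n} (λ i → χ i ℤ.* b ℤ.+ (1ℤ ℤ.- χ i) ℤ.* c)
        ≡⟨ ℤΣ.sum-cong-≗ {2 * n} (λ i → regroup (χ i) b c) ⟩
      ℤΣ.sum {2 * n} (λ i → (b ℤ.- c) ℤ.* χ i ℤ.+ c ℤ.* 1ℤ)
        ≡⟨ ℤΣ.∑-distrib-+ {2 * n} (λ i → (b ℤ.- c) ℤ.* χ i) (λ i → c ℤ.* 1ℤ) ⟩
      ℤΣ.sum {2 * n} (λ i → (b ℤ.- c) ℤ.* χ i) ℤ.+ ℤΣ.sum {2 * n} (λ i → c ℤ.* 1ℤ)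
        ≡⟨ cong₂ ℤ._+_
             (trans (sum-distribˡ-* {2 * n} (b ℤ.- c) χ) (cong (λ k → (b ℤ.- c) ℤ.* k) sumV-χ))
             (trans (sum-distribˡ-* {2 * n} c (λ _ → 1ℤ)) (cong (λ k → c ℤ.* k)
               (trans (sum-ones (2 * n)) (cong +_ (cong (λ k → n + k) (ℕ.+-identityʳ n)))))) ⟩
      (b ℤ.- c) ℤ.* N ℤ.+ c ℤ.* (N ℤ.+ N)
        ≡⟨ collect b c N ⟩
      N ℤ.* b ℤ.+ N ℤ.* c ∎

  -- Multiplication by the idempotent χ keeps the shape `affine`: it masks y, drops c, and drops t
  -- because v₂ is not in the class. The sum is then a case of `sum-affine`.
  sumA-affine : ∀ a y b c s t → sumA (affine a y b c s t) ≡ a ℤ.* sumA y ℤ.+ N ℤ.* b ℤ.+ s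
  sumA-affine a y b c s t = trans
    (ℤΣ.sum-cong-≗ (λ i → mask i (χ-idempotent i)))
    (trans (sum-affine a (λ i → χ i ℤ.* y i) b 0ℤ s 0ℤ)
      (tidy (a ℤ.* sumA y) (N ℤ.* b) N s))
    where
    tidy : ∀ u v k s → u ℤ.+ (v ℤ.+ k ℤ.* 0ℤ) ℤ.+ (s ℤ.+ 0ℤ) ≡ u ℤ.+ v ℤ.+ s
    tidy = solve-∀
    expand : ∀ x z e → x ℤ.* (a ℤ.* z ℤ.+ (x ℤ.* b ℤ.+ (1ℤ ℤ.- x) ℤ.* c) ℤ.+ e) ≡
      a ℤ.* (x ℤ.* z) ℤ.+ (x ℤ.* x ℤ.* b ℤ.+ (x ℤ.- x ℤ.* x) ℤ.* c) ℤ.+ x ℤ.* e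
    expand x z e = identity a b c x z e
      where
      identity : ∀ a b c x z e → x ℤ.* (a ℤ.* z ℤ.+ (x ℤ.* b ℤ.+ (1ℤ ℤ.- x) ℤ.* c) ℤ.+ e) ≡
        a ℤ.* (x ℤ.* z) ℤ.+ (x ℤ.* x ℤ.* b ℤ.+ (x ℤ.- x ℤ.* x) ℤ.* c) ℤ.+ x ℤ.* e
      identity = solve-∀
    reduce : ∀ x z e → a ℤ.* (x ℤ.* z) ℤ.+ (x ℤ.* b ℤ.+ (x ℤ.- x) ℤ.* c) ℤ.+ e ≡
      a ℤ.* (x ℤ.* z) ℤ.+ (x ℤ.* b ℤ.+ (1ℤ ℤ.- x) ℤ.* 0ℤ) ℤ.+ e
    reduce x z e = identity a b c x z e
      where
      identity : ∀ a b c x z e → a ℤ.* (x ℤ.* z) ℤ.+ (x ℤ.* b ℤ.+ (x ℤ.- x) ℤ.* c) ℤ.+ e ≡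
        a ℤ.* (x ℤ.* z) ℤ.+ (x ℤ.* b ℤ.+ (1ℤ ℤ.- x) ℤ.* 0ℤ) ℤ.+ e
      identity = solve-∀
    χ-ends : ∀ i → χ i ℤ.* ends s t i ≡ ends s 0ℤ i
    χ-ends zero          = ℤ.*-identityˡ s
    χ-ends (suc zero)    = ℤ.*-zeroˡ t
    χ-ends (suc (suc i)) = ℤ.*-zeroʳ (χ (suc (suc i)))
    mask : ∀ i → χ i ℤ.* χ i ≡ χ i →
      χ i ℤ.* affine a y b c s t i ≡ affine a (λ i → χ i ℤ.* y i) b 0ℤ s 0ℤ i
    mask i idem = trans (expand (χ i) (y i) (ends s t i))
      (trans (cong₂ (λ q e → a ℤ.* (χ i ℤ.* y i) ℤ.+ (q ℤ.* b ℤ.+ (χ i ℤ.- q) ℤ.* c) ℤ.+ e) idem (χ-ends i))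
        (reduce (χ i) (y i) (ends s 0ℤ i)))

  sumB-affine : ∀ a y b c s t → sumB (affine a y b c s t) ≡ a ℤ.* sumB y ℤ.+ N ℤ.* c ℤ.+ t
  sumB-affine a y b c s t = begin
    sumB x                           ≡⟨ isolate (sumA x) (sumB x) ⟩
    (sumA x ℤ.+ sumB x) ℤ.- sumA x   ≡⟨ cong₂ ℤ._-_ (trans (sumA+sumB x) (sum-affine a y b c s t)) (sumA-affine a y b c s t) ⟩
    (a ℤ.* ℤΣ.sum y ℤ.+ (N ℤ.* b ℤ.+ N ℤ.* c) ℤ.+ (s ℤ.+ t)) ℤ.- (a ℤ.* sumA y ℤ.+ N ℤ.* b ℤ.+ s)
      ≡⟨ cong (λ w → (a ℤ.* w ℤ.+ (N ℤ.* b ℤ.+ N ℤ.* c) ℤ.+ (s ℤ.+ t)) ℤ.- (a ℤ.* sumA y ℤ.+ N ℤ.* b ℤ.+ s)) (sym (sumA+sumB y)) ⟩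
    (a ℤ.* (sumA y ℤ.+ sumB y) ℤ.+ (N ℤ.* b ℤ.+ N ℤ.* c) ℤ.+ (s ℤ.+ t)) ℤ.- (a ℤ.* sumA y ℤ.+ N ℤ.* b ℤ.+ s)
      ≡⟨ simplify a (sumA y) (sumB y) (N ℤ.* b) (N ℤ.* c) s t ⟩
    a ℤ.* sumB y ℤ.+ N ℤ.* c ℤ.+ t   ∎
    where
    open ≡-Reasoning
    x = affine a y b c s t
    isolate : ∀ u v → v ≡ (u ℤ.+ v) ℤ.- u
    isolate = solve-∀
    simplify : ∀ a u v b c s t →
      (a ℤ.* (u ℤ.+ v) ℤ.+ (b ℤ.+ c) ℤ.+ (s ℤ.+ t)) ℤ.- (a ℤ.* u ℤ.+ b ℤ.+ s) ≡ a ℤ.* v ℤ.+ c ℤ.+ t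
    simplify = solve-∀

  slice : (Fin (2 * n * d) → ℤ) → V → Fin d → ℤ
  slice z i g = z (i at g)

  laplacianRow : (V → Fin d → ℤ) → V → Fin d → ℤ
  laplacianRow z i g = affine N (λ j → z j g) (ℤ.- classB z g) (ℤ.- classA z g)
    (z v₂ g ℤ.- z v₂ (rotate 1ℤ g)) (z v₁ g ℤ.- z v₁ (rotate -1ℤ g)) i

  row-neighbours : ∀ z i g → N ℤ.* z i g ℤ.- neighbours z i g ≡ laplacianRow z i g
  row-neighbours z i g = trans
    (negate (N ℤ.* z i g) (χ i) (classB z g) (classA z g) (twist z i g))
    (cong (λ e → N ℤ.* z i g ℤ.+ (χ i ℤ.* (ℤ.- classB z g) ℤ.+ (1ℤ ℤ.- χ i) ℤ.* (ℤ.- classA z g)) ℤ.+ e) (ends-neg i))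
    where
    negate : ∀ u x b a e → u ℤ.- (x ℤ.* b ℤ.+ (1ℤ ℤ.- x) ℤ.* a ℤ.+ e) ≡
      u ℤ.+ (x ℤ.* (ℤ.- b) ℤ.+ (1ℤ ℤ.- x) ℤ.* (ℤ.- a)) ℤ.+ (ℤ.- e)
    negate = solve-∀
    flip : ∀ u v → ℤ.- (u ℤ.- v) ≡ v ℤ.- u
    flip = solve-∀
    ends-neg : ∀ i → ℤ.- twist z i g ≡
      ends (z v₂ g ℤ.- z v₂ (rotate 1ℤ g)) (z v₁ g ℤ.- z v₁ (rotate -1ℤ g)) i
    ends-neg zero          = flip (z v₂ (rotate 1ℤ g)) (z v₂ g)
    ends-neg (suc zero)    = flip (z v₁ (rotate -1ℤ g)) (z v₁ g)
    ends-neg (suc (suc i)) = refl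

  laplacianRow-cong : ∀ {z z′} → (∀ i g → z i g ≡ z′ i g) → ∀ i g → laplacianRow z i g ≡ laplacianRow z′ i g
  laplacianRow-cong {z} {z′} z≗z′ i g = cong₂ ℤ._+_
    (cong₂ ℤ._+_ (cong (N ℤ.*_) (z≗z′ i g))
      (cong₂ (λ b a → χ i ℤ.* (ℤ.- b) ℤ.+ (1ℤ ℤ.- χ i) ℤ.* (ℤ.- a))
        (ℤΣ.sum-cong-≗ (λ j → cong ((1ℤ ℤ.- χ j) ℤ.*_) (z≗z′ j g)))
        (ℤΣ.sum-cong-≗ (λ j → cong (χ j ℤ.*_) (z≗z′ j g)))))
    (cong₂ (λ s t → ends s t i)
      (cong₂ ℤ._-_ (z≗z′ v₂ g) (z≗z′ v₂ (rotate 1ℤ g)))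
      (cong₂ ℤ._-_ (z≗z′ v₁ g) (z≗z′ v₁ (rotate -1ℤ g))))

  -- This gives the regularity of the cover: the degree is the neighbour sum of the constant
  -- function 1, on which the twist vanishes.
  neighbours-ones : ∀ i g → neighbours (λ _ _ → 1ℤ) i g ≡ N
  neighbours-ones i g = begin
    χ i ℤ.* sumB ones ℤ.+ (1ℤ ℤ.- χ i) ℤ.* sumA ones ℤ.+ twist (λ _ _ → 1ℤ) i g
      ≡⟨ cong₂ (λ b a → χ i ℤ.* b ℤ.+ (1ℤ ℤ.- χ i) ℤ.* a ℤ.+ twist (λ _ _ → 1ℤ) i g) B≡n A≡n ⟩
    χ i ℤ.* N ℤ.+ (1ℤ ℤ.- χ i) ℤ.* N ℤ.+ twist (λ _ _ → 1ℤ) i g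
      ≡⟨ cong (λ e → χ i ℤ.* N ℤ.+ (1ℤ ℤ.- χ i) ℤ.* N ℤ.+ e) (untwisted i) ⟩
    χ i ℤ.* N ℤ.+ (1ℤ ℤ.- χ i) ℤ.* N ℤ.+ 0ℤ
      ≡⟨ collapse (χ i) N ⟩
    N ∎
    where
    open ≡-Reasoning
    ones : V → ℤ
    ones _ = 1ℤ
    collapse : ∀ x k → x ℤ.* k ℤ.+ (1ℤ ℤ.- x) ℤ.* k ℤ.+ 0ℤ ≡ k
    collapse = solve-∀
    untwisted : ∀ i → twist (λ _ _ → 1ℤ) i g ≡ 0ℤ
    untwisted zero          = refl
    untwisted (suc zero)    = refl
    untwisted (suc (suc i)) = refl
    decompose : ∀ i → 1ℤ ≡ affine 0ℤ (λ _ → 0ℤ) 1ℤ 1ℤ 0ℤ 0ℤ i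
    decompose i = trans (identity (χ i)) (cong (λ e → 0ℤ ℤ.* 0ℤ ℤ.+ (χ i ℤ.* 1ℤ ℤ.+ (1ℤ ℤ.- χ i) ℤ.* 1ℤ) ℤ.+ e) (sym (no-ends i)))
      where
      identity : ∀ x → 1ℤ ≡ 0ℤ ℤ.* 0ℤ ℤ.+ (x ℤ.* 1ℤ ℤ.+ (1ℤ ℤ.- x) ℤ.* 1ℤ) ℤ.+ 0ℤ
      identity = solve-∀
      no-ends : ∀ i → ends 0ℤ 0ℤ i ≡ 0ℤ
      no-ends zero          = refl
      no-ends (suc zero)    = refl
      no-ends (suc (suc i)) = refl
    tidy : ∀ a k → 0ℤ ℤ.* a ℤ.+ k ℤ.* 1ℤ ℤ.+ 0ℤ ≡ k
    tidy a k = trans (cong (λ u → u ℤ.+ k ℤ.* 1ℤ ℤ.+ 0ℤ) (ℤ.*-zeroˡ a)) (simplify k)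
      where
      simplify : ∀ k → 0ℤ ℤ.+ k ℤ.* 1ℤ ℤ.+ 0ℤ ≡ k
      simplify = solve-∀
    A≡n : sumA ones ≡ N
    A≡n = trans (ℤΣ.sum-cong-≗ (λ i → cong (χ i ℤ.*_) (decompose i)))
      (trans (sumA-affine 0ℤ (λ _ → 0ℤ) 1ℤ 1ℤ 0ℤ 0ℤ) (tidy (sumA (λ _ → 0ℤ)) N))
    B≡n : sumB ones ≡ N
    B≡n = trans (ℤΣ.sum-cong-≗ (λ i → cong ((1ℤ ℤ.- χ i) ℤ.*_) (decompose i)))
      (trans (sumB-affine 0ℤ (λ _ → 0ℤ) 1ℤ 1ℤ 0ℤ 0ℤ) (tidy (sumB (λ _ → 0ℤ)) N))

  degree-at : ∀ i g → ℤΣ.sum (adjacency (i at g)) ≡ N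
  degree-at i g = trans (ℤΣ.sum-cong-≗ (λ k → sym (ℤ.*-identityʳ (adjacency (i at g) k))))
    (trans (sum-adjacency (λ _ → 1ℤ) i g) (neighbours-ones i g))

  laplacian-at : ∀ z i g → (laplacian *ᵥ z) (i at g) ≡ laplacianRow (slice z) i g
  laplacian-at z i g = begin
    ℤΣ.sum (λ l → laplacian k l ℤ.* z l)
      ≡⟨ ℤΣ.sum-cong-≗ (λ l → trans
           (cong (λ e → (e ℤ.- adjacency k l) ℤ.* z l) (indicator-≟ k l (ℤΣ.sum (adjacency k))))
           (distribute (single k D l) (adjacency k l) (z l))) ⟩
    ℤΣ.sum (λ l → single k D l ℤ.* z l ℤ.+ -1ℤ ℤ.* (adjacency k l ℤ.* z l))
      ≡⟨ ℤΣ.∑-distrib-+ (λ l → single k D l ℤ.* z l) (λ l → -1ℤ ℤ.* (adjacency k l ℤ.* z l)) ⟩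
    ℤΣ.sum (λ l → single k D l ℤ.* z l) ℤ.+ ℤΣ.sum (λ l → -1ℤ ℤ.* (adjacency k l ℤ.* z l))
      ≡⟨ cong₂ ℤ._+_ (trans (sum-single k D z) (cong (λ e → e ℤ.* z k) (degree-at i g)))
           (trans (sum-distribˡ-* -1ℤ (λ l → adjacency k l ℤ.* z l))
             (trans (ℤ.-1*i≡-i _) (cong ℤ.-_ (sum-adjacency z i g)))) ⟩
    N ℤ.* z k ℤ.- neighbours (slice z) i g
      ≡⟨ row-neighbours (slice z) i g ⟩
    laplacianRow (slice z) i g ∎
    where
    open ≡-Reasoning
    k = i at g
    D = ℤΣ.sum (adjacency k)
    distribute : ∀ x y z → (x ℤ.- y) ℤ.* z ≡ x ℤ.* z ℤ.+ -1ℤ ℤ.* (y ℤ.* z)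
    distribute = solve-∀

  -- Elimination down to the fibre of v₂, and back-substitution

  columnSum : (V → Fin d → ℤ) → Fin d → ℤ
  columnSum y g = ℤΣ.sum (λ i → y i g)

  sum-columnSum : ∀ x → ℤΣ.sum x ≡ ℤΣ.sum (columnSum (slice x))
  sum-columnSum x = trans (sum-combine (2 * n) {d} x) (ℤΣ.∑-comm {2 * n} {d} (slice x))

  -- A solution P of (τ − 1) P = columnSum y, where (τ f) g = f (rotate -1ℤ g).
  potential : (V → Fin d → ℤ) → Fin d → ℤ
  potential y g = ℤ.- prefixSum (columnSum y) g

  potential-rotate : ∀ y → ℤΣ.sum (columnSum y) ≡ 0ℤ →
    ∀ g → potential y (rotate -1ℤ g) ≡ potential y g ℤ.+ columnSum y g
  potential-rotate y Σ≡0 g = begin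
    ℤ.- p′               ≡⟨ shift p′ w ⟩
    ℤ.- (p′ ℤ.+ w) ℤ.+ w ≡⟨ cong (λ s → ℤ.- s ℤ.+ w) (prefixSum-rotate (columnSum y) Σ≡0 g) ⟨
    ℤ.- prefixSum (columnSum y) g ℤ.+ w ∎
    where
    open ≡-Reasoning
    p′ = prefixSum (columnSum y) (rotate -1ℤ g)
    w = columnSum y g
    shift : ∀ p w → ℤ.- p ≡ ℤ.- (p ℤ.+ w) ℤ.+ w
    shift = solve-∀

  -- Rotation preserves the sum of q, so its increments add up to 0. It gives total 0 both for
  -- images of the Laplacian and for the vectors used to hit the target.
  columnSum-rotate⇒sum≡0 : ∀ y (q : Fin d → ℤ) →
    (∀ g → q (rotate -1ℤ g) ≡ q g ℤ.+ columnSum y g) → ℤΣ.sum (columnSum y) ≡ 0ℤ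
  columnSum-rotate⇒sum≡0 y q q-rotate = begin
    W                            ≡⟨ isolate (ℤΣ.sum q) W ⟩
    (ℤΣ.sum q ℤ.+ W) ℤ.- ℤΣ.sum q ≡⟨ cong (ℤ._- ℤΣ.sum q) (ℤΣ.∑-distrib-+ q (columnSum y)) ⟨
    ℤΣ.sum (λ g → q g ℤ.+ columnSum y g) ℤ.- ℤΣ.sum q
      ≡⟨ cong (ℤ._- ℤΣ.sum q) (ℤΣ.sum-cong-≗ q-rotate) ⟨
    ℤΣ.sum (λ g → q (rotate -1ℤ g)) ℤ.- ℤΣ.sum q ≡⟨ cong (ℤ._- ℤΣ.sum q) (sum-rotate⁻¹ q) ⟩
    ℤΣ.sum q ℤ.- ℤΣ.sum q        ≡⟨ ℤ.+-inverseʳ (ℤΣ.sum q) ⟩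
    0ℤ                           ∎
    where
    open ≡-Reasoning
    W = ℤΣ.sum (columnSum y)
    isolate : ∀ u v → v ≡ (u ℤ.+ v) ℤ.- u
    isolate = solve-∀

  -- Two antidifferences of the same column sums differ by a rotation-invariant function.
  potential-unique : ∀ y (q : Fin d → ℤ) → (∀ g → q (rotate -1ℤ g) ≡ q g ℤ.+ columnSum y g) →
    ∀ g → potential y g ≡ q g ℤ.+ (potential y zero ℤ.- q zero)
  potential-unique y q q-rotate g = begin
    P g                       ≡⟨ split (P g) (q g) ⟩
    q g ℤ.+ (P g ℤ.- q g)     ≡⟨ cong (λ s → q g ℤ.+ s) (rotation-invariant⇒constant (λ g → P g ℤ.- q g) invariant g) ⟩
    q g ℤ.+ (P zero ℤ.- q zero) ∎
    where
    open ≡-Reasoning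
    P = potential y
    split : ∀ u v → u ≡ v ℤ.+ (u ℤ.- v)
    split = solve-∀
    cancel : ∀ u v w → (u ℤ.+ w) ℤ.- (v ℤ.+ w) ≡ u ℤ.- v
    cancel = solve-∀
    invariant : ∀ g → P (rotate -1ℤ g) ℤ.- q (rotate -1ℤ g) ≡ P g ℤ.- q g
    invariant g = trans
      (cong₂ ℤ._-_ (potential-rotate y (columnSum-rotate⇒sum≡0 y q q-rotate) g) (q-rotate g))
      (cancel (P g) (q g) (columnSum y g))

  -- The coefficients come from the elimination. Let y be the image of z, with A and B the class
  -- sums of z and z₁, z₂ its values on the fibres of v₁ and v₂. Up to a constant, n²P is n²(τ⁻¹z₂ -
  -- z₁). Adding n(y₁ - y₂) trades -n²z₁ for -n²z₂ at the cost of n(A - B) and lower terms.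
  -- Subtracting a, which is n(A - B) + z₂ - τ⁻¹z₂, removes the class sums, and nW removes the
  -- remaining n(z₁ - τz₁). The coefficients n², -2n and 1 left on τ⁻¹z₂ - z₂ form (n - 1)².
  formula : ℤ → ℤ → ℤ → ℤ → ℤ → ℤ → ℤ
  formula k P W a y₁ y₂ = k ℤ.* k ℤ.* P ℤ.+ k ℤ.* W ℤ.- a ℤ.+ k ℤ.* (y₁ ℤ.- y₂)

  -- Eliminating all the unknowns of laplacianRow z ≡ y except z v₂ leaves the equation
  -- residual y ≡ (n − 1)² (τ⁻¹ − 1) (z v₂), up to an additive constant.
  residual : (V → Fin d → ℤ) → Fin d → ℤ
  residual y g = formula N (potential y g) (columnSum y g) (classA y g) (y v₁ g) (y v₂ g)

  residual-cong : ∀ {y z} → (∀ i g → y i g ≡ z i g) → ∀ g → residual y g ≡ residual z g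
  residual-cong {y} {z} y≗z g = begin
    formula N (potential y g) (columnSum y g) (classA y g) (y v₁ g) (y v₂ g)
      ≡⟨ cong₂ (λ P W → formula N P W (classA y g) (y v₁ g) (y v₂ g))
           (cong ℤ.-_ (prefixSum-cong columns g)) (columns g) ⟩
    formula N (potential z g) (columnSum z g) (classA y g) (y v₁ g) (y v₂ g)
      ≡⟨ cong₂ (λ a b → formula N (potential z g) (columnSum z g) a b (y v₂ g))
           (ℤΣ.sum-cong-≗ (λ i → cong (χ i ℤ.*_) (y≗z i g))) (y≗z v₁ g) ⟩
    formula N (potential z g) (columnSum z g) (classA z g) (z v₁ g) (y v₂ g)
      ≡⟨ cong (formula N (potential z g) (columnSum z g) (classA z g) (z v₁ g)) (y≗z v₂ g) ⟩
    formula N (potential z g) (columnSum z g) (classA z g) (z v₁ g) (z v₂ g) ∎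
    where
    open ≡-Reasoning
    columns : ∀ g → columnSum y g ≡ columnSum z g
    columns g = ℤΣ.sum-cong-≗ (λ i → y≗z i g)

  residual-+ : ∀ y z g → residual (λ i g → y i g ℤ.+ z i g) g ≡ residual y g ℤ.+ residual z g
  residual-+ y z g = trans
    (cong₂ (λ P a → formula N P (columnSum (λ i g → y i g ℤ.+ z i g) g) a (y v₁ g ℤ.+ z v₁ g) (y v₂ g ℤ.+ z v₂ g))
      potentials classes)
    (trans
      (cong (λ W → formula N (potential y g ℤ.+ potential z g) W (classA y g ℤ.+ classA z g)
        (y v₁ g ℤ.+ z v₁ g) (y v₂ g ℤ.+ z v₂ g)) (columns g))
      (identity N (potential y g) (potential z g) (columnSum y g) (columnSum z g)
        (classA y g) (classA z g) (y v₁ g) (z v₁ g) (y v₂ g) (z v₂ g)))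
    where
    columns : ∀ g → columnSum (λ i g → y i g ℤ.+ z i g) g ≡ columnSum y g ℤ.+ columnSum z g
    columns g = ℤΣ.∑-distrib-+ (λ i → y i g) (λ i → z i g)
    potentials : potential (λ i g → y i g ℤ.+ z i g) g ≡ potential y g ℤ.+ potential z g
    potentials = trans
      (cong ℤ.-_ (trans (prefixSum-cong columns g) (prefixSum-+ (columnSum y) (columnSum z) g)))
      (ℤ.neg-distrib-+ (prefixSum (columnSum y) g) (prefixSum (columnSum z) g))
    classes : classA (λ i g → y i g ℤ.+ z i g) g ≡ classA y g ℤ.+ classA z g
    classes = trans
      (ℤΣ.sum-cong-≗ (λ i → ℤ.*-distribˡ-+ (χ i) (y i g) (z i g)))
      (ℤΣ.∑-distrib-+ (λ i → χ i ℤ.* y i g) (λ i → χ i ℤ.* z i g))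
    identity : ∀ k P P′ W W′ a a′ y y′ z z′ →
      k ℤ.* k ℤ.* (P ℤ.+ P′) ℤ.+ k ℤ.* (W ℤ.+ W′) ℤ.- (a ℤ.+ a′) ℤ.+ k ℤ.* ((y ℤ.+ y′) ℤ.- (z ℤ.+ z′)) ≡
      (k ℤ.* k ℤ.* P ℤ.+ k ℤ.* W ℤ.- a ℤ.+ k ℤ.* (y ℤ.- z)) ℤ.+
      (k ℤ.* k ℤ.* P′ ℤ.+ k ℤ.* W′ ℤ.- a′ ℤ.+ k ℤ.* (y′ ℤ.- z′))
    identity = solve-∀

  [n-1]² : ℤ
  [n-1]² = (N ℤ.- 1ℤ) ℤ.* (N ℤ.- 1ℤ)

  columnSum-laplacianRow : ∀ z g → columnSum (laplacianRow z) g ≡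
    (z v₂ g ℤ.- z v₂ (rotate 1ℤ g)) ℤ.+ (z v₁ g ℤ.- z v₁ (rotate -1ℤ g))
  columnSum-laplacianRow z g = trans
    (sum-affine N (λ i → z i g) (ℤ.- classB z g) (ℤ.- classA z g)
      (z v₂ g ℤ.- z v₂ (rotate 1ℤ g)) (z v₁ g ℤ.- z v₁ (rotate -1ℤ g)))
    (trans
      (cong (λ s → N ℤ.* s ℤ.+ (N ℤ.* (ℤ.- classB z g) ℤ.+ N ℤ.* (ℤ.- classA z g)) ℤ.+
        ((z v₂ g ℤ.- z v₂ (rotate 1ℤ g)) ℤ.+ (z v₁ g ℤ.- z v₁ (rotate -1ℤ g))))
        (sym (sumA+sumB (λ i → z i g))))
      (cancel N (classA z g) (classB z g) _))
    where
    cancel : ∀ k a b s → k ℤ.* (a ℤ.+ b) ℤ.+ (k ℤ.* (ℤ.- b) ℤ.+ k ℤ.* (ℤ.- a)) ℤ.+ s ≡ s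
    cancel = solve-∀

  -- Summed over a sheet, the image of z retains only the lifts of the edge v₁v₂. This is the
  -- difference of z along the lift that starts at v₁ in sheet g, so the column sum is the incoming
  -- minus the outgoing flow: an explicit antidifference.
  flow : (V → Fin d → ℤ) → Fin d → ℤ
  flow z g = z v₂ (rotate 1ℤ g) ℤ.- z v₁ g

  flow-rotate : ∀ z g → flow z (rotate -1ℤ g) ≡ flow z g ℤ.+ columnSum (laplacianRow z) g
  flow-rotate z g = begin
    z v₂ (rotate 1ℤ (rotate -1ℤ g)) ℤ.- z v₁ (rotate -1ℤ g)
      ≡⟨ cong (λ h → z v₂ h ℤ.- z v₁ (rotate -1ℤ g)) (rotate-inverse -1ℤ g) ⟩
    z v₂ g ℤ.- z v₁ (rotate -1ℤ g)
      ≡⟨ telescope (z v₂ g) (z v₁ (rotate -1ℤ g)) (z v₂ (rotate 1ℤ g)) (z v₁ g) ⟩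
    flow z g ℤ.+ ((z v₂ g ℤ.- z v₂ (rotate 1ℤ g)) ℤ.+ (z v₁ g ℤ.- z v₁ (rotate -1ℤ g)))
      ≡⟨ cong (λ s → flow z g ℤ.+ s) (columnSum-laplacianRow z g) ⟨
    flow z g ℤ.+ columnSum (laplacianRow z) g ∎
    where
    open ≡-Reasoning
    telescope : ∀ a b c d → a ℤ.- b ≡ (c ℤ.- d) ℤ.+ ((a ℤ.- c) ℤ.+ (d ℤ.- b))
    telescope = solve-∀

  sum-laplacian : ∀ z → ℤΣ.sum (laplacian *ᵥ z) ≡ 0ℤ
  sum-laplacian z = trans (sum-columnSum (laplacian *ᵥ z))
    (trans (ℤΣ.sum-cong-≗ (λ g → ℤΣ.sum-cong-≗ (λ i → laplacian-at z i g)))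
      (columnSum-rotate⇒sum≡0 (laplacianRow (slice z)) (flow (slice z)) (flow-rotate (slice z))))

  residual-laplacianRow : ∀ z → ∃ λ c → ∀ g →
    residual (laplacianRow z) g ≡ [n-1]² ℤ.* (z v₂ (rotate 1ℤ g) ℤ.- z v₂ g) ℤ.+ c
  -- The offset c₀ between the potential and the flow enters `formula` only through P, whose
  -- coefficient is n².
  residual-laplacianRow z = N ℤ.* N ℤ.* c₀ , λ g → begin
    residual y g
      ≡⟨ cong₂ (λ P W → formula N P W (classA y g) (y v₁ g) (y v₂ g))
           (potential-unique y (flow z) (flow-rotate z) g) (columnSum-laplacianRow z g) ⟩
    formula N (flow z g ℤ.+ c₀) (w g) (classA y g) (y v₁ g) (y v₂ g)
      ≡⟨ cong (λ a → formula N (flow z g ℤ.+ c₀) (w g) a (y v₁ g) (y v₂ g))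
           (sumA-affine N (λ i → z i g) (ℤ.- classB z g) (ℤ.- classA z g)
             (z v₂ g ℤ.- z v₂ (rotate 1ℤ g)) (z v₁ g ℤ.- z v₁ (rotate -1ℤ g))) ⟩
    _ ≡⟨ identity N c₀ (classA z g) (classB z g) (z v₁ g) (z v₂ g) (z v₁ (rotate -1ℤ g)) (z v₂ (rotate 1ℤ g)) ⟩
    [n-1]² ℤ.* (z v₂ (rotate 1ℤ g) ℤ.- z v₂ g) ℤ.+ N ℤ.* N ℤ.* c₀ ∎
    where
    open ≡-Reasoning
    y = laplacianRow z
    c₀ = potential y zero ℤ.- flow z zero
    w : Fin d → ℤ
    w g = (z v₂ g ℤ.- z v₂ (rotate 1ℤ g)) ℤ.+ (z v₁ g ℤ.- z v₁ (rotate -1ℤ g))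
    identity : ∀ k c a b z₁ z₂ z₁′ z₂′ →
      k ℤ.* k ℤ.* ((z₂′ ℤ.- z₁) ℤ.+ c) ℤ.+ k ℤ.* ((z₂ ℤ.- z₂′) ℤ.+ (z₁ ℤ.- z₁′))
        ℤ.- (k ℤ.* a ℤ.+ k ℤ.* (ℤ.- b) ℤ.+ (z₂ ℤ.- z₂′))
        ℤ.+ k ℤ.* ((k ℤ.* z₁ ℤ.+ (1ℤ ℤ.* (ℤ.- b) ℤ.+ 0ℤ ℤ.* (ℤ.- a)) ℤ.+ (z₂ ℤ.- z₂′))
          ℤ.- (k ℤ.* z₂ ℤ.+ (0ℤ ℤ.* (ℤ.- b) ℤ.+ 1ℤ ℤ.* (ℤ.- a)) ℤ.+ (z₁ ℤ.- z₁′))) ≡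
      (k ℤ.- 1ℤ) ℤ.* (k ℤ.- 1ℤ) ℤ.* (z₂′ ℤ.- z₂) ℤ.+ k ℤ.* k ℤ.* c
    identity = solve-∀

  -- Back-substitution for the right-hand side n³κy. The fibre of v₂ gets n³h, the flow relation
  -- gives the fibre of v₁, the rows of v₁ and v₂ prescribe the class sums, and the other rows give
  -- the rest. It remains to verify that the prescribed class sums are the actual ones, and there
  -- the residual equation enters. The power of n clears denominators.
  solvable : ∀ y κ (h : Fin d → ℤ) c → ℤΣ.sum (columnSum y) ≡ 0ℤ →
    (∀ g → κ ℤ.* residual y g ≡ [n-1]² ℤ.* (h (rotate 1ℤ g) ℤ.- h g) ℤ.+ c) →
    ∃ λ z → ∀ i g → N ℤ.* N ℤ.* N ℤ.* κ ℤ.* y i g ≡ laplacianRow z i g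
  solvable y κ h c Σ≡0 residual≡ = z , solves
    where
    open ≡-Reasoning
    P W a : Fin d → ℤ
    P = potential y
    W = columnSum y
    a = classA y

    first second fromB fromA : Fin d → ℤ
    -- The scaled residual has constant term n³c, and P has coefficient n² in it, so the flow must
    -- be n³κP - nc; subtracting it from the rotated n³h gives this value.
    first g  = N ℤ.* N ℤ.* N ℤ.* (h (rotate 1ℤ g) ℤ.- κ ℤ.* P g) ℤ.+ N ℤ.* c
    second g = N ℤ.* N ℤ.* N ℤ.* h g
    -- `fromB` and `fromA` are the intended class sums divided by n, obtained by solving the rows of
    -- v₁ and v₂; they are integral as written.
    fromB g  = first g ℤ.- N ℤ.* N ℤ.* (h (rotate 1ℤ g) ℤ.- h g) ℤ.- N ℤ.* N ℤ.* κ ℤ.* y v₁ g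
    fromA g  = second g ℤ.- N ℤ.* N ℤ.* (h g ℤ.- h (rotate 1ℤ g) ℤ.- κ ℤ.* W g) ℤ.- N ℤ.* N ℤ.* κ ℤ.* y v₂ g

    z : V → Fin d → ℤ
    -- An untwisted row says that n z minus the opposite class sum is n³κy, whence n²κy plus that
    -- sum over n. The last two arguments reset the entries at v₁ and v₂ to `first` and `second`.
    z i g = affine (N ℤ.* N ℤ.* κ) (λ j → y j g) (fromB g) (fromA g)
      (first g ℤ.- N ℤ.* N ℤ.* κ ℤ.* y v₁ g ℤ.- fromB g)
      (second g ℤ.- N ℤ.* N ℤ.* κ ℤ.* y v₂ g ℤ.- fromA g) i

    z-v₁ : ∀ g → z v₁ g ≡ first g
    z-v₁ g = identity (N ℤ.* N ℤ.* κ ℤ.* y v₁ g) (fromB g) (fromA g) (first g)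
      where
      identity : ∀ u b a f → u ℤ.+ (1ℤ ℤ.* b ℤ.+ 0ℤ ℤ.* a) ℤ.+ (f ℤ.- u ℤ.- b) ≡ f
      identity = solve-∀

    z-v₂ : ∀ g → z v₂ g ≡ second g
    z-v₂ g = identity (N ℤ.* N ℤ.* κ ℤ.* y v₂ g) (fromB g) (fromA g) (second g)
      where
      identity : ∀ u b a f → u ℤ.+ (0ℤ ℤ.* b ℤ.+ 1ℤ ℤ.* a) ℤ.+ (f ℤ.- u ℤ.- a) ≡ f
      identity = solve-∀

    -- Serves as a rewrite rule for the class sum of y; after it, both class sums of z are verified
    -- by polynomial identities.
    κa : ∀ g → κ ℤ.* a g ≡ κ ℤ.* (N ℤ.* N ℤ.* P g ℤ.+ N ℤ.* W g ℤ.+ N ℤ.* (y v₁ g ℤ.- y v₂ g))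
      ℤ.- ([n-1]² ℤ.* (h (rotate 1ℤ g) ℤ.- h g) ℤ.+ c)
    κa g = trans
      (isolate κ (a g) (N ℤ.* N ℤ.* P g) (N ℤ.* W g) (N ℤ.* (y v₁ g ℤ.- y v₂ g)))
      (cong (λ s → κ ℤ.* (N ℤ.* N ℤ.* P g ℤ.+ N ℤ.* W g ℤ.+ N ℤ.* (y v₁ g ℤ.- y v₂ g)) ℤ.- s) (residual≡ g))
      where
      isolate : ∀ κ a u v w → κ ℤ.* a ≡ κ ℤ.* (u ℤ.+ v ℤ.+ w) ℤ.- κ ℤ.* (u ℤ.+ v ℤ.- a ℤ.+ w)
      isolate = solve-∀

    classA-z : ∀ g → classA z g ≡ N ℤ.* fromA g
    classA-z g = begin
      classA z g
        ≡⟨ sumA-affine (N ℤ.* N ℤ.* κ) (λ j → y j g) (fromB g) (fromA g)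
             (first g ℤ.- N ℤ.* N ℤ.* κ ℤ.* y v₁ g ℤ.- fromB g)
             (second g ℤ.- N ℤ.* N ℤ.* κ ℤ.* y v₂ g ℤ.- fromA g) ⟩
      N ℤ.* N ℤ.* κ ℤ.* a g ℤ.+ N ℤ.* fromB g ℤ.+ (first g ℤ.- N ℤ.* N ℤ.* κ ℤ.* y v₁ g ℤ.- fromB g)
        ≡⟨ cong (λ s → s ℤ.+ N ℤ.* fromB g ℤ.+ (first g ℤ.- N ℤ.* N ℤ.* κ ℤ.* y v₁ g ℤ.- fromB g))
             (trans (ℤ.*-assoc (N ℤ.* N) κ (a g)) (cong (λ s → N ℤ.* N ℤ.* s) (κa g))) ⟩
      _ ≡⟨ identity N κ (P g) (W g) (y v₁ g) (y v₂ g) (h g) (h (rotate 1ℤ g)) c ⟩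
      N ℤ.* fromA g ∎
      where
      identity : ∀ k κ P W y₁ y₂ h h′ c →
        let f = k ℤ.* k ℤ.* k ℤ.* (h′ ℤ.- κ ℤ.* P) ℤ.+ k ℤ.* c
            b = f ℤ.- k ℤ.* k ℤ.* (h′ ℤ.- h) ℤ.- k ℤ.* k ℤ.* κ ℤ.* y₁ in
        k ℤ.* k ℤ.* (κ ℤ.* (k ℤ.* k ℤ.* P ℤ.+ k ℤ.* W ℤ.+ k ℤ.* (y₁ ℤ.- y₂))
          ℤ.- ((k ℤ.- 1ℤ) ℤ.* (k ℤ.- 1ℤ) ℤ.* (h′ ℤ.- h) ℤ.+ c))
          ℤ.+ k ℤ.* b ℤ.+ (f ℤ.- k ℤ.* k ℤ.* κ ℤ.* y₁ ℤ.- b) ≡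
        k ℤ.* (k ℤ.* k ℤ.* k ℤ.* h ℤ.- k ℤ.* k ℤ.* (h ℤ.- h′ ℤ.- κ ℤ.* W) ℤ.- k ℤ.* k ℤ.* κ ℤ.* y₂)
      identity = solve-∀

    classB-z : ∀ g → classB z g ≡ N ℤ.* fromB g
    classB-z g = begin
      classB z g
        ≡⟨ sumB-affine (N ℤ.* N ℤ.* κ) (λ j → y j g) (fromB g) (fromA g)
             (first g ℤ.- N ℤ.* N ℤ.* κ ℤ.* y v₁ g ℤ.- fromB g)
             (second g ℤ.- N ℤ.* N ℤ.* κ ℤ.* y v₂ g ℤ.- fromA g) ⟩
      N ℤ.* N ℤ.* κ ℤ.* classB y g ℤ.+ N ℤ.* fromA g ℤ.+ (second g ℤ.- N ℤ.* N ℤ.* κ ℤ.* y v₂ g ℤ.- fromA g)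
        ≡⟨ cong (λ s → s ℤ.+ N ℤ.* fromA g ℤ.+ (second g ℤ.- N ℤ.* N ℤ.* κ ℤ.* y v₂ g ℤ.- fromA g))
             (trans (split N κ (a g) (classB y g))
               (cong₂ (λ w s → N ℤ.* N ℤ.* (κ ℤ.* w ℤ.- s)) (sumA+sumB (λ j → y j g)) (κa g))) ⟩
      _ ≡⟨ identity N κ (P g) (W g) (y v₁ g) (y v₂ g) (h g) (h (rotate 1ℤ g)) c ⟩
      N ℤ.* fromB g ∎
      where
      split : ∀ k κ a b → k ℤ.* k ℤ.* κ ℤ.* b ≡ k ℤ.* k ℤ.* (κ ℤ.* (a ℤ.+ b) ℤ.- κ ℤ.* a)
      split = solve-∀
      identity : ∀ k κ P W y₁ y₂ h h′ c →
        let s = k ℤ.* k ℤ.* k ℤ.* h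
            a = s ℤ.- k ℤ.* k ℤ.* (h ℤ.- h′ ℤ.- κ ℤ.* W) ℤ.- k ℤ.* k ℤ.* κ ℤ.* y₂ in
        k ℤ.* k ℤ.* (κ ℤ.* W ℤ.- (κ ℤ.* (k ℤ.* k ℤ.* P ℤ.+ k ℤ.* W ℤ.+ k ℤ.* (y₁ ℤ.- y₂))
          ℤ.- ((k ℤ.- 1ℤ) ℤ.* (k ℤ.- 1ℤ) ℤ.* (h′ ℤ.- h) ℤ.+ c)))
          ℤ.+ k ℤ.* a ℤ.+ (s ℤ.- k ℤ.* k ℤ.* κ ℤ.* y₂ ℤ.- a) ≡
        k ℤ.* (k ℤ.* k ℤ.* k ℤ.* (h′ ℤ.- κ ℤ.* P) ℤ.+ k ℤ.* c
          ℤ.- k ℤ.* k ℤ.* (h′ ℤ.- h) ℤ.- k ℤ.* k ℤ.* κ ℤ.* y₁)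
      identity = solve-∀

    row : ℤ → ℤ → ℤ → ℤ → ℤ → ℤ
    row u x b a e = N ℤ.* u ℤ.+ (x ℤ.* (ℤ.- b) ℤ.+ (1ℤ ℤ.- x) ℤ.* (ℤ.- a)) ℤ.+ e

    solves : ∀ i g → N ℤ.* N ℤ.* N ℤ.* κ ℤ.* y i g ≡ laplacianRow z i g
    solves zero g = sym (begin
      laplacianRow z v₁ g
        ≡⟨ cong₂ (λ b a → row (z v₁ g) 1ℤ b a (z v₂ g ℤ.- z v₂ (rotate 1ℤ g))) (classB-z g) (classA-z g) ⟩
      row (z v₁ g) 1ℤ (N ℤ.* fromB g) (N ℤ.* fromA g) (z v₂ g ℤ.- z v₂ (rotate 1ℤ g))
        ≡⟨ cong₂ (λ u e → row u 1ℤ (N ℤ.* fromB g) (N ℤ.* fromA g) e) (z-v₁ g)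
             (cong₂ ℤ._-_ (z-v₂ g) (z-v₂ (rotate 1ℤ g))) ⟩
      row (first g) 1ℤ (N ℤ.* fromB g) (N ℤ.* fromA g) (second g ℤ.- second (rotate 1ℤ g))
        ≡⟨ identity N κ (first g) (h g) (h (rotate 1ℤ g)) (y v₁ g) (fromA g) ⟩
      N ℤ.* N ℤ.* N ℤ.* κ ℤ.* y v₁ g ∎)
      where
      identity : ∀ k κ f h h′ y a →
        k ℤ.* f ℤ.+ (1ℤ ℤ.* (ℤ.- (k ℤ.* (f ℤ.- k ℤ.* k ℤ.* (h′ ℤ.- h) ℤ.- k ℤ.* k ℤ.* κ ℤ.* y)))
          ℤ.+ (1ℤ ℤ.- 1ℤ) ℤ.* (ℤ.- (k ℤ.* a)))
          ℤ.+ (k ℤ.* k ℤ.* k ℤ.* h ℤ.- k ℤ.* k ℤ.* k ℤ.* h′) ≡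
        k ℤ.* k ℤ.* k ℤ.* κ ℤ.* y
      identity = solve-∀
    solves (suc zero) g = sym (begin
      laplacianRow z v₂ g
        ≡⟨ cong₂ (λ b a → row (z v₂ g) 0ℤ b a (z v₁ g ℤ.- z v₁ (rotate -1ℤ g))) (classB-z g) (classA-z g) ⟩
      row (z v₂ g) 0ℤ (N ℤ.* fromB g) (N ℤ.* fromA g) (z v₁ g ℤ.- z v₁ (rotate -1ℤ g))
        ≡⟨ cong₂ (λ u e → row u 0ℤ (N ℤ.* fromB g) (N ℤ.* fromA g) e) (z-v₂ g)
             (cong₂ ℤ._-_ (z-v₁ g) (trans (z-v₁ (rotate -1ℤ g)) first-rotate)) ⟩
      row (second g) 0ℤ (N ℤ.* fromB g) (N ℤ.* fromA g)
        (first g ℤ.- (N ℤ.* N ℤ.* N ℤ.* (h g ℤ.- κ ℤ.* (P g ℤ.+ W g)) ℤ.+ N ℤ.* c))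
        ≡⟨ identity N κ (P g) (W g) (h g) (h (rotate 1ℤ g)) c (y v₂ g) (fromB g) ⟩
      N ℤ.* N ℤ.* N ℤ.* κ ℤ.* y v₂ g ∎)
      where
      first-rotate : first (rotate -1ℤ g) ≡ N ℤ.* N ℤ.* N ℤ.* (h g ℤ.- κ ℤ.* (P g ℤ.+ W g)) ℤ.+ N ℤ.* c
      first-rotate = cong₂ (λ u v → N ℤ.* N ℤ.* N ℤ.* (h u ℤ.- κ ℤ.* v) ℤ.+ N ℤ.* c)
        (rotate-inverse -1ℤ g) (potential-rotate y Σ≡0 g)
      identity : ∀ k κ P W h h′ c y b →
        k ℤ.* (k ℤ.* k ℤ.* k ℤ.* h) ℤ.+ (0ℤ ℤ.* (ℤ.- (k ℤ.* b))
          ℤ.+ (1ℤ ℤ.- 0ℤ) ℤ.* (ℤ.- (k ℤ.* (k ℤ.* k ℤ.* k ℤ.* h ℤ.- k ℤ.* k ℤ.* (h ℤ.- h′ ℤ.- κ ℤ.* W) ℤ.- k ℤ.* k ℤ.* κ ℤ.* y))))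
          ℤ.+ ((k ℤ.* k ℤ.* k ℤ.* (h′ ℤ.- κ ℤ.* P) ℤ.+ k ℤ.* c)
            ℤ.- (k ℤ.* k ℤ.* k ℤ.* (h ℤ.- κ ℤ.* (P ℤ.+ W)) ℤ.+ k ℤ.* c)) ≡
        k ℤ.* k ℤ.* k ℤ.* κ ℤ.* y
      identity = solve-∀
    solves (suc (suc i)) g = sym (begin
      laplacianRow z (suc (suc i)) g
        ≡⟨ cong₂ (λ b a → row (z (suc (suc i)) g) x b a 0ℤ) (classB-z g) (classA-z g) ⟩
      row (z (suc (suc i)) g) x (N ℤ.* fromB g) (N ℤ.* fromA g) 0ℤ
        ≡⟨ identity N κ (y (suc (suc i)) g) x (fromB g) (fromA g) ⟩
      N ℤ.* N ℤ.* N ℤ.* κ ℤ.* y (suc (suc i)) g ∎)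
      where
      x : ℤ
      x = χ {2 * n} (suc (suc i))
      identity : ∀ k κ y x b a →
        k ℤ.* (k ℤ.* k ℤ.* κ ℤ.* y ℤ.+ (x ℤ.* b ℤ.+ (1ℤ ℤ.- x) ℤ.* a) ℤ.+ 0ℤ)
          ℤ.+ (x ℤ.* (ℤ.- (k ℤ.* b)) ℤ.+ (1ℤ ℤ.- x) ℤ.* (ℤ.- (k ℤ.* a))) ℤ.+ 0ℤ ≡
        k ℤ.* k ℤ.* k ℤ.* κ ℤ.* y
      identity = solve-∀

  -- The vector (τ - 1)f placed on the fibre of v₂. It has total 0 and antidifference f, its class
  -- sum over A vanishes, and in `formula` the terms nW and -n y₂ cancel. What remains is n²f up to
  -- a constant, which is the origin of the factor n² in the image.
  divisorOf : (Fin d → ℤ) → V → Fin d → ℤ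
  divisorOf f i g = ends 0ℤ (f (rotate -1ℤ g) ℤ.- f g) i

  columnSum-divisorOf : ∀ f g → columnSum (divisorOf f) g ≡ f (rotate -1ℤ g) ℤ.- f g
  columnSum-divisorOf f g = trans (ℤ.+-identityˡ _)
    (trans (cong (λ s → (f (rotate -1ℤ g) ℤ.- f g) ℤ.+ s) (sum-zero {n′ + suc (suc (n′ + 0))} (λ _ → refl)))
      (ℤ.+-identityʳ _))

  divisorOf-rotate : ∀ f g → f (rotate -1ℤ g) ≡ f g ℤ.+ columnSum (divisorOf f) g
  divisorOf-rotate f g = trans (split (f (rotate -1ℤ g)) (f g))
    (cong (λ s → f g ℤ.+ s) (sym (columnSum-divisorOf f g)))
    where
    split : ∀ u v → u ≡ v ℤ.+ (u ℤ.- v)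
    split = solve-∀

  residual-divisorOf : ∀ f → ∃ λ c → ∀ g → residual (divisorOf f) g ≡ N ℤ.* N ℤ.* f g ℤ.+ c
  residual-divisorOf f = N ℤ.* N ℤ.* c₀ , λ g → trans
    (cong₂ (λ P W → formula N P W (classA (divisorOf f) g) 0ℤ (f (rotate -1ℤ g) ℤ.- f g))
      (potential-unique (divisorOf f) f (divisorOf-rotate f) g) (columnSum-divisorOf f g))
    (trans
      (cong (λ a → formula N (f g ℤ.+ c₀) (f (rotate -1ℤ g) ℤ.- f g) a 0ℤ (f (rotate -1ℤ g) ℤ.- f g))
        (sum-zero (no-A g)))
      (identity N (f g) (f (rotate -1ℤ g) ℤ.- f g) c₀))
    where
    c₀ = potential (divisorOf f) zero ℤ.- f zero
    no-A : ∀ g i → χ i ℤ.* divisorOf f i g ≡ 0ℤ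
    no-A g zero          = refl
    no-A g (suc zero)    = ℤ.*-zeroˡ (f (rotate -1ℤ g) ℤ.- f g)
    no-A g (suc (suc i)) = ℤ.*-zeroʳ (χ (suc (suc i)))
    identity : ∀ k f w c → k ℤ.* k ℤ.* (f ℤ.+ c) ℤ.+ k ℤ.* w ℤ.- 0ℤ ℤ.+ k ℤ.* (0ℤ ℤ.- w) ≡
      k ℤ.* k ℤ.* f ℤ.+ k ℤ.* k ℤ.* c
    identity = solve-∀

-- The Sylow subgroup of the Jacobian

sum-const : ∀ k c → ℤΣ.sum {k} (λ _ → c) ≡ + k ℤ.* c
sum-const zero    c = sym (ℤ.*-zeroˡ c)
sum-const (suc k) c = trans (cong (λ s → c ℤ.+ s) (sum-const k c)) (sym (ℤ.suc-* (+ k) c))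

sum-∣ : ∀ {k} m (f : Fin k → ℤ) → (∀ i → m ℤ∣.∣ f i) → m ℤ∣.∣ ℤΣ.sum f
sum-∣ {zero}  m f m∣f = ℤ∣.divides 0ℤ (sym (ℤ.*-zeroˡ m))
sum-∣ {suc k} m f m∣f = ℤ∣.∣m∣n⇒∣m+n (m∣f zero) (sum-∣ m (f ∘ suc) (m∣f ∘ suc))

laplacian-const : ∀ (X : Graph) z c i → let open Graph X in
  (laplacian *ᵥ (λ j → z j ℤ.+ c)) i ≡ (laplacian *ᵥ z) i
laplacian-const X z c i = begin
  ℤΣ.sum (λ j → laplacian i j ℤ.* (z j ℤ.+ c))
    ≡⟨ ℤΣ.sum-cong-≗ (λ j → distribute (laplacian i j) (z j) c) ⟩
  ℤΣ.sum (λ j → laplacian i j ℤ.* z j ℤ.+ c ℤ.* laplacian i j)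
    ≡⟨ ℤΣ.∑-distrib-+ (λ j → laplacian i j ℤ.* z j) (λ j → c ℤ.* laplacian i j) ⟩
  (laplacian *ᵥ z) i ℤ.+ ℤΣ.sum (λ j → c ℤ.* laplacian i j)
    ≡⟨ cong (λ s → (laplacian *ᵥ z) i ℤ.+ s)
         (trans (sum-distribˡ-* c (laplacian i)) (trans (cong (c ℤ.*_) row-sum) (ℤ.*-zeroʳ c))) ⟩
  (laplacian *ᵥ z) i ℤ.+ 0ℤ
    ≡⟨ ℤ.+-identityʳ _ ⟩
  (laplacian *ᵥ z) i ∎
  where
  open ≡-Reasoning
  open Graph X
  D = ℤΣ.sum (adjacency i)
  distribute : ∀ l z c → l ℤ.* (z ℤ.+ c) ≡ l ℤ.* z ℤ.+ c ℤ.* l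
  distribute = solve-∀
  unit-weights : ∀ s a → s ℤ.- a ≡ s ℤ.* 1ℤ ℤ.+ -1ℤ ℤ.* a
  unit-weights = solve-∀
  row-sum : ℤΣ.sum (laplacian i) ≡ 0ℤ
  row-sum = begin
    ℤΣ.sum (laplacian i)
      ≡⟨ ℤΣ.sum-cong-≗ (λ j → trans (cong (ℤ._- adjacency i j) (indicator-≟ i j D))
           (unit-weights (single i D j) (adjacency i j))) ⟩
    ℤΣ.sum (λ j → single i D j ℤ.* 1ℤ ℤ.+ -1ℤ ℤ.* adjacency i j)
      ≡⟨ ℤΣ.∑-distrib-+ (λ j → single i D j ℤ.* 1ℤ) (λ j → -1ℤ ℤ.* adjacency i j) ⟩
    ℤΣ.sum (λ j → single i D j ℤ.* 1ℤ) ℤ.+ ℤΣ.sum (λ j → -1ℤ ℤ.* adjacency i j)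
      ≡⟨ cong₂ ℤ._+_ (trans (sum-single i D (λ _ → 1ℤ)) (ℤ.*-identityʳ D))
           (trans (sum-distribˡ-* -1ℤ (adjacency i)) (ℤ.-1*i≡-i D)) ⟩
    D ℤ.- D
      ≡⟨ ℤ.+-inverseʳ D ⟩
    0ℤ ∎

-- Functions on the cycle modulo constants

module _ {k : ℕ} where
  private
    d : ℕ
    d = suc (suc k)

  difference : (Fin d → ℤ) → Fin d → ℤ
  difference f g = f g ℤ.- f zero

  -- Coordinates on ℤ^d modulo constants. The entry at 1 is recovered from the total.
  entries : (Fin d → ℤ) → Fin k → ℤ
  entries f i = difference f (suc (suc i))

  total : (Fin d → ℤ) → ℤ
  total f = ℤΣ.sum (difference f)

  -- Membership in the submodule of ℤ^d generated by the constants and the image of m(τ⁻¹ - 1), that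
  -- is, triviality in R/(N, m(τ - 1)).
  record Coboundary (m : ℤ) (f : Fin d → ℤ) : Set where
    constructor coboundary
    field
      antidifference : Fin d → ℤ
      constant       : ℤ
      equation       : ∀ g → f g ≡ m ℤ.* (antidifference (rotate 1ℤ g) ℤ.- antidifference g) ℤ.+ constant

  module _ (m : ℤ) (f : Fin d → ℤ) where
    -- With u = τ⁻¹h - h, the difference of f from its value at 0 is m(u - u 0). Since u sums to 0,
    -- the total is -dm u 0, which is where the factor d appears.
    coboundary⇒∣ : Coboundary m f → (∀ i → m ℤ∣.∣ entries f i) × + d ℤ.* m ℤ∣.∣ total f
    coboundary⇒∣ (coboundary h c f≡) =
      (λ i → ℤ∣.divides (u (suc (suc i)) ℤ.- u zero)
        (trans (difference≡ (suc (suc i))) (ℤ.*-comm m (u (suc (suc i)) ℤ.- u zero)))) ,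
      ℤ∣.divides (ℤ.- u zero) total≡
      where
      open ≡-Reasoning
      u : Fin d → ℤ
      u g = h (rotate 1ℤ g) ℤ.- h g
      cancel : ∀ m u v c → (m ℤ.* u ℤ.+ c) ℤ.- (m ℤ.* v ℤ.+ c) ≡ m ℤ.* (u ℤ.- v)
      cancel = solve-∀
      difference≡ : ∀ g → difference f g ≡ m ℤ.* (u g ℤ.- u zero)
      difference≡ g = trans (cong₂ ℤ._-_ (f≡ g) (f≡ zero)) (cancel m (u g) (u zero) c)
      total≡ : total f ≡ (ℤ.- u zero) ℤ.* (+ d ℤ.* m)
      total≡ = begin
        total f
          ≡⟨ ℤΣ.sum-cong-≗ difference≡ ⟩
        ℤΣ.sum (λ g → m ℤ.* (u g ℤ.- u zero))
          ≡⟨ sum-distribˡ-* m (λ g → u g ℤ.- u zero) ⟩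
        m ℤ.* ℤΣ.sum (λ g → u g ℤ.- u zero)
          ≡⟨ cong (m ℤ.*_) (sum-difference u (ℤ.- u zero)) ⟩
        m ℤ.* (ℤΣ.sum u ℤ.+ + d ℤ.* (ℤ.- u zero))
          ≡⟨ cong (λ s → m ℤ.* (s ℤ.+ + d ℤ.* (ℤ.- u zero))) sum-u ⟩
        m ℤ.* (0ℤ ℤ.+ + d ℤ.* (ℤ.- u zero))
          ≡⟨ rearrange m (+ d) (ℤ.- u zero) ⟩
        (ℤ.- u zero) ℤ.* (+ d ℤ.* m) ∎
        where
        sum-difference : ∀ (f : Fin d → ℤ) c → ℤΣ.sum (λ g → f g ℤ.+ c) ≡ ℤΣ.sum f ℤ.+ + d ℤ.* c
        sum-difference f c = trans (ℤΣ.∑-distrib-+ f (λ _ → c)) (cong (λ s → ℤΣ.sum f ℤ.+ s) (sum-const d c))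
        rearrange : ∀ m d v → m ℤ.* (0ℤ ℤ.+ d ℤ.* v) ≡ v ℤ.* (d ℤ.* m)
        rearrange = solve-∀
        sum-u : ℤΣ.sum u ≡ 0ℤ
        sum-u = begin
          ℤΣ.sum u
            ≡⟨ ℤΣ.∑-distrib-+ (λ g → h (rotate 1ℤ g)) (λ g → ℤ.- h g) ⟩
          ℤΣ.sum (λ g → h (rotate 1ℤ g)) ℤ.+ ℤΣ.sum (λ g → ℤ.- h g)
            ≡⟨ cong₂ ℤ._+_ (sum-rotate h) (trans (ℤΣ.sum-cong-≗ (λ g → sym (ℤ.-1*i≡-i (h g))))
                 (trans (sum-distribˡ-* -1ℤ h) (ℤ.-1*i≡-i (ℤΣ.sum h)))) ⟩
          ℤΣ.sum h ℤ.- ℤΣ.sum h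
            ≡⟨ ℤ.+-inverseʳ (ℤΣ.sum h) ⟩
          0ℤ ∎

    -- With f − f 0 = m q and Σ q = d k, the vector q − k has total 0, so it is (τ⁻¹ − 1) h
    -- for a shifted sequence of partial sums h.
    ∣⇒coboundary : .{{_ : ℤ.NonZero m}} →
      (∀ i → m ℤ∣.∣ entries f i) → + d ℤ.* m ℤ∣.∣ total f → Coboundary m f
    ∣⇒coboundary m∣entries (ℤ∣.divides t total≡) = coboundary h (f zero ℤ.+ m ℤ.* t) λ g → begin
      f g                                        ≡⟨ restore (f g) (f zero) ⟩
      f zero ℤ.+ difference f g                  ≡⟨ cong (λ s → f zero ℤ.+ s) (difference≡ g) ⟩
      f zero ℤ.+ q g ℤ.* m                       ≡⟨ regroup (f zero) (q g) m t ⟩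
      m ℤ.* w g ℤ.+ (f zero ℤ.+ m ℤ.* t)         ≡⟨ cong (λ s → m ℤ.* s ℤ.+ (f zero ℤ.+ m ℤ.* t)) (h-rotate g) ⟨
      m ℤ.* (h (rotate 1ℤ g) ℤ.- h g) ℤ.+ (f zero ℤ.+ m ℤ.* t) ∎
      where
      open ≡-Reasoning
      m∣total : m ℤ∣.∣ total f
      m∣total = ℤ∣.divides (t ℤ.* + d) (trans total≡ (sym (ℤ.*-assoc t (+ d) m)))

      m∣zero : m ℤ∣.∣ difference f zero
      m∣zero = ℤ∣.divides 0ℤ (trans (ℤ.+-inverseʳ (f zero)) (sym (ℤ.*-zeroˡ m)))

      m∣difference : ∀ g → m ℤ∣.∣ difference f g
      m∣difference zero          = m∣zero
      -- The entry at 1 is not a coordinate; its divisibility follows from that of the total and of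
      -- all other entries.
      m∣difference (suc zero)    = ℤ∣.∣m+n∣n⇒∣m {n = ℤΣ.sum (entries f)}
        (ℤ∣.∣m+n∣m⇒∣n m∣total m∣zero) (sum-∣ m (entries f) m∣entries)
      m∣difference (suc (suc i)) = m∣entries i

      q w h : Fin d → ℤ
      q g = ℤ∣._∣_.quotient (m∣difference g)
      w g = q g ℤ.- t
      -- The shift by one turns the backward differences of the partial sums into forward
      -- differences.
      h g = prefixSum w (rotate -1ℤ g)

      difference≡ : ∀ g → difference f g ≡ q g ℤ.* m
      difference≡ g = ℤ∣._∣_.equality (m∣difference g)

      restore : ∀ u v → u ≡ v ℤ.+ (u ℤ.- v)
      restore = solve-∀
      regroup : ∀ f q m t → f ℤ.+ q ℤ.* m ≡ m ℤ.* (q ℤ.- t) ℤ.+ (f ℤ.+ m ℤ.* t)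
      regroup = solve-∀

      sum-q : ℤΣ.sum q ≡ t ℤ.* + d
      -- That m is nonzero enters here, by cancellation.
      sum-q = ℤ.*-cancelʳ-≡ _ _ m (begin
        ℤΣ.sum q ℤ.* m              ≡⟨ ℤΣ.*-distribʳ-sum m q ⟩
        ℤΣ.sum (λ g → q g ℤ.* m)    ≡⟨ ℤΣ.sum-cong-≗ difference≡ ⟨
        total f                     ≡⟨ total≡ ⟩
        t ℤ.* (+ d ℤ.* m)           ≡⟨ ℤ.*-assoc t (+ d) m ⟨
        t ℤ.* + d ℤ.* m             ∎)

      sum-w : ℤΣ.sum w ≡ 0ℤ
      sum-w = begin
        ℤΣ.sum w                             ≡⟨ ℤΣ.∑-distrib-+ q (λ _ → ℤ.- t) ⟩
        ℤΣ.sum q ℤ.+ ℤΣ.sum {d} (λ _ → ℤ.- t) ≡⟨ cong₂ ℤ._+_ sum-q (sum-const d (ℤ.- t)) ⟩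
        t ℤ.* + d ℤ.+ + d ℤ.* (ℤ.- t)        ≡⟨ cancel t (+ d) ⟩
        0ℤ                                   ∎
        where
        cancel : ∀ t d → t ℤ.* d ℤ.+ d ℤ.* (ℤ.- t) ≡ 0ℤ
        cancel = solve-∀

      h-rotate : ∀ g → h (rotate 1ℤ g) ℤ.- h g ≡ w g
      h-rotate g = begin
        prefixSum w (rotate -1ℤ (rotate 1ℤ g)) ℤ.- h g
          ≡⟨ cong (λ i → prefixSum w i ℤ.- h g) (rotate-inverse 1ℤ g) ⟩
        prefixSum w g ℤ.- h g          ≡⟨ cong (ℤ._- h g) (prefixSum-rotate w sum-w g) ⟩
        (h g ℤ.+ w g) ℤ.- h g          ≡⟨ cancel (h g) (w g) ⟩
        w g                            ∎
        where
        cancel : ∀ u v → (u ℤ.+ v) ℤ.- u ≡ v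
        cancel = solve-∀

  fromCoordinates : (Fin k → ℤ) → ℤ → Fin d → ℤ
  fromCoordinates q r zero          = 0ℤ
  fromCoordinates q r (suc zero)    = r ℤ.- ℤΣ.sum q
  fromCoordinates q r (suc (suc i)) = q i

  entries-fromCoordinates : ∀ q r i → entries (fromCoordinates q r) i ≡ q i
  entries-fromCoordinates q r i = ℤ.+-identityʳ (q i)

  total-fromCoordinates : ∀ q r → total (fromCoordinates q r) ≡ r
  total-fromCoordinates q r = trans
    (cong (λ s → 0ℤ ℤ.+ (r ℤ.- ℤΣ.sum q ℤ.- 0ℤ ℤ.+ s)) (ℤΣ.sum-cong-≗ (entries-fromCoordinates q r)))
    (cancel r (ℤΣ.sum q))
    where
    cancel : ∀ r s → 0ℤ ℤ.+ (r ℤ.- s ℤ.- 0ℤ ℤ.+ s) ≡ r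
    cancel = solve-∀

  module _ {f f′ : Fin d → ℤ} (c c′ : ℤ) (f≡ : ∀ g → f g ≡ c ℤ.* f′ g ℤ.+ c′) where
    difference-affine : ∀ g → difference f g ≡ c ℤ.* difference f′ g
    difference-affine g = trans (cong₂ ℤ._-_ (f≡ g) (f≡ zero)) (cancel c c′ (f′ g) (f′ zero))
      where
      cancel : ∀ c e u v → (c ℤ.* u ℤ.+ e) ℤ.- (c ℤ.* v ℤ.+ e) ≡ c ℤ.* (u ℤ.- v)
      cancel = solve-∀

    total-affine : total f ≡ c ℤ.* total f′
    total-affine = trans (ℤΣ.sum-cong-≗ difference-affine) (sum-distribˡ-* c (difference f′))

sylow-graph-jacobian : ∀ (X : Graph) v → let open Graph X in
  (∀ z → ℤΣ.sum (laplacian *ᵥ z) ≡ 0ℤ) → ∀ (B : Ab) →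
  let module B = AbelianGroup B ; open Multiples B in
  ∀ {p e c c′} → Prime p → p ∤ c → p ∤ c′ →
  (φ : (Fin order → ℤ) → B.Carrier) →
  (∀ {x y} → (∀ i → x i ≡ y i) → φ x B.≈ φ y) →
  (∀ x y → φ (λ i → x i ℤ.+ y i) B.≈ φ x B.∙ φ y) →
  (∀ z → φ (laplacian *ᵥ z) B.≈ B.ε) →
  (∀ x → ℤΣ.sum x ≡ 0ℤ → φ x B.≈ B.ε → ∃ λ z → ∀ i → + c ℤ.* x i ≡ (laplacian *ᵥ z) i) →
  (∀ b → ∃ λ x → ℤΣ.sum x ≡ 0ℤ × φ x B.≈ c′ · b) →
  (∀ b → (p ^ e) · b B.≈ B.ε) →
  Sylow p (jacobian v) ≅ B
sylow-graph-jacobian X v sum-laplacian B {p} {e} {c} {c′} =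
  sylow-reduced-cokernel laplacian (index v) sum-laplacian (laplacian-const X) B {p} {e} {c} {c′}
  where open Graph X

-- If p divided q, then p^(a + 1) would divide m.
largestPower-quotient : ∀ {p a m q} → IsLargestPower p a m → m ≡ q * p ^ a → p ∤ q
largestPower-quotient {p} {a} {m} (_ , maximal) refl (divides r refl) =
  ℕ.1+n≰n (maximal (suc a) (divides r (ℕ.*-assoc r p (p ^ a))))

module _ (n′ k p a b : ℕ) (p-prime : Prime p) (p∤n : p ∤ suc (suc n′))
  (a-largest : IsLargestPower p a (suc n′)) (b-largest : IsLargestPower p b (suc (suc k)))
  where
  private
    n d : ℕ
    n = suc (suc n′)
    d = suc (suc k)
    Y = singleVoltageCover n d
    M₁ = p ^ (2 * a)
    M₂ = p ^ (2 * a + b)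
    B = (ℤ/ M₁) ^⊕ k ⊕ (ℤ/ M₂)
    module B = AbelianGroup B
    module Z₁ = AbelianGroup (ℤ/ M₁)
    module Z₂ = AbelianGroup (ℤ/ M₂)
    module MB = Multiples B
    open Graph Y using (laplacian)
    open Cover n′ (suc k)

    m : ℤ
    m = [n-1]²

    α β κ : ℕ
    α = _∣_.quotient (proj₁ a-largest)
    β = _∣_.quotient (proj₁ b-largest)
    -- Since (n - 1)² = α² p^(2a) and d(n - 1)² = κ p^(2a + b), multiplication by κ raises
    -- divisibility by the two powers of p to divisibility by m and by dm, and p does not divide κ.
    κ = α * α * β

    p∤α : p ∤ α
    p∤α = largestPower-quotient a-largest (_∣_.equality (proj₁ a-largest))

    p∤β : p ∤ β
    p∤β = largestPower-quotient b-largest (_∣_.equality (proj₁ b-largest))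

    m≡ : m ≡ + (α * α) ℤ.* + M₁
    m≡ = begin
      m                              ≡⟨ ℤ.pos-* (suc n′) (suc n′) ⟨
      + (suc n′ * suc n′)            ≡⟨ cong (λ u → + (u * u)) (_∣_.equality (proj₁ a-largest)) ⟩
      + (α * p ^ a * (α * p ^ a))    ≡⟨ cong +_ (ℕ.[m*n]*[o*p]≡[m*o]*[n*p] α (p ^ a) α (p ^ a)) ⟩
      + (α * α * (p ^ a * p ^ a))    ≡⟨ cong (λ u → + (α * α * u)) (ℕ.^-distribˡ-+-* p a a) ⟨
      + (α * α * p ^ (a + a))        ≡⟨ cong (λ u → + (α * α * p ^ (a + u))) (ℕ.+-identityʳ a) ⟨
      + (α * α * M₁)                 ≡⟨ ℤ.pos-* (α * α) M₁ ⟩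
      + (α * α) ℤ.* + M₁             ∎
      where open ≡-Reasoning

    dm≡ : + d ℤ.* m ≡ + κ ℤ.* + M₂
    dm≡ = begin
      + d ℤ.* m                                        ≡⟨ cong₂ (λ u v → + u ℤ.* v) (_∣_.equality (proj₁ b-largest)) m≡ ⟩
      + (β * p ^ b) ℤ.* (+ (α * α) ℤ.* + M₁)           ≡⟨ cong (ℤ._* (+ (α * α) ℤ.* + M₁)) (ℤ.pos-* β (p ^ b)) ⟩
      + β ℤ.* + (p ^ b) ℤ.* (+ (α * α) ℤ.* + M₁)       ≡⟨ rearrange (+ β) (+ (p ^ b)) (+ (α * α)) (+ M₁) ⟩
      + (α * α) ℤ.* + β ℤ.* (+ M₁ ℤ.* + (p ^ b))       ≡⟨ cong₂ ℤ._*_ (ℤ.pos-* (α * α) β) (ℤ.pos-* M₁ (p ^ b)) ⟨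
      + κ ℤ.* + (M₁ * p ^ b)                           ≡⟨ cong (λ u → + κ ℤ.* + u) (ℕ.^-distribˡ-+-* p (2 * a) b) ⟨
      + κ ℤ.* + M₂                                     ∎
      where
      open ≡-Reasoning
      rearrange : ∀ β q α m → β ℤ.* q ℤ.* (α ℤ.* m) ≡ α ℤ.* β ℤ.* (m ℤ.* q)
      rearrange = solve-∀

    M₁∣m : + M₁ ℤ∣.∣ m
    M₁∣m = ℤ∣.divides (+ (α * α)) m≡

    M₂∣dm : + M₂ ℤ∣.∣ + d ℤ.* m
    M₂∣dm = ℤ∣.divides (+ κ) dm≡

    coordinates : (Fin d → ℤ) → B.Carrier
    coordinates f = entries f , total f

    coordinates-cong : ∀ {f f′} → (∀ g → f g ≡ f′ g) → coordinates f B.≈ coordinates f′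
    coordinates-cong f≗f′ =
      (λ i → Z₁.reflexive (cong₂ ℤ._-_ (f≗f′ (suc (suc i))) (f≗f′ zero))) ,
      Z₂.reflexive (ℤΣ.sum-cong-≗ (λ g → cong₂ ℤ._-_ (f≗f′ g) (f≗f′ zero)))

    coordinates-+ : ∀ f f′ → coordinates (λ g → f g ℤ.+ f′ g) B.≈ coordinates f B.∙ coordinates f′
    coordinates-+ f f′ =
      (λ i → Z₁.reflexive (interchange (f (suc (suc i))) (f′ (suc (suc i))) (f zero) (f′ zero))) ,
      Z₂.reflexive (trans
        (ℤΣ.sum-cong-≗ (λ g → interchange (f g) (f′ g) (f zero) (f′ zero)))
        (ℤΣ.∑-distrib-+ (difference f) (difference f′)))
      where
      interchange : ∀ u v w x → (u ℤ.+ v) ℤ.- (w ℤ.+ x) ≡ (u ℤ.- w) ℤ.+ (v ℤ.- x)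
      interchange = solve-∀

    ∣⇒≈0 : ∀ {M x} → + M ℤ∣.∣ x → + M ℤ∣.∣ x ℤ.- 0ℤ
    ∣⇒≈0 {M} {x} = subst (+ M ℤ∣.∣_) (sym (ℤ.+-identityʳ x))

    ≈0⇒∣ : ∀ {M x} → + M ℤ∣.∣ x ℤ.- 0ℤ → + M ℤ∣.∣ x
    ≈0⇒∣ {M} {x} = subst (+ M ℤ∣.∣_) (ℤ.+-identityʳ x)

    coboundary⇒≈ε : ∀ f → Coboundary m f → coordinates f B.≈ B.ε
    coboundary⇒≈ε f c =
      (λ i → ∣⇒≈0 {M₁} {entries f i} (ℤ∣.∣-trans M₁∣m (proj₁ (coboundary⇒∣ m f c) i))) ,
      ∣⇒≈0 {M₂} {total f} (ℤ∣.∣-trans M₂∣dm (proj₂ (coboundary⇒∣ m f c)))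

    ≈ε⇒coboundary : ∀ f → coordinates f B.≈ B.ε → Coboundary m (λ g → + κ ℤ.* f g)
    ≈ε⇒coboundary f (entries≈0 , total≈0) = ∣⇒coboundary m (λ g → + κ ℤ.* f g)
      (λ i → subst (m ℤ∣.∣_) (sym (scaled-entries i)) (m∣ (≈0⇒∣ {M₁} {entries f i} (entries≈0 i))))
      (subst (+ d ℤ.* m ℤ∣.∣_) (sym scaled-total) (dm∣ (≈0⇒∣ {M₂} {total f} total≈0)))
      where
      scale : ∀ g → + κ ℤ.* f g ≡ + κ ℤ.* f g ℤ.+ 0ℤ
      scale g = sym (ℤ.+-identityʳ _)
      scaled-entries : ∀ i → entries (λ g → + κ ℤ.* f g) i ≡ + κ ℤ.* entries f i
      scaled-entries i = difference-affine {f′ = f} (+ κ) 0ℤ scale (suc (suc i))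
      scaled-total : total (λ g → + κ ℤ.* f g) ≡ + κ ℤ.* total f
      scaled-total = total-affine {f′ = f} (+ κ) 0ℤ scale
      m∣ : ∀ {x} → + M₁ ℤ∣.∣ x → m ℤ∣.∣ + κ ℤ.* x
      m∣ {x} (ℤ∣.divides q x≡) = ℤ∣.divides (+ β ℤ.* q) (begin
        + κ ℤ.* x                                 ≡⟨ cong₂ ℤ._*_ (ℤ.pos-* (α * α) β) x≡ ⟩
        + (α * α) ℤ.* + β ℤ.* (q ℤ.* + M₁)        ≡⟨ rearrange (+ (α * α)) (+ β) q (+ M₁) ⟩
        + β ℤ.* q ℤ.* (+ (α * α) ℤ.* + M₁)        ≡⟨ cong (λ u → + β ℤ.* q ℤ.* u) m≡ ⟨
        + β ℤ.* q ℤ.* m                           ∎)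
        where
        open ≡-Reasoning
        rearrange : ∀ α β q m → α ℤ.* β ℤ.* (q ℤ.* m) ≡ β ℤ.* q ℤ.* (α ℤ.* m)
        rearrange = solve-∀
      dm∣ : ∀ {x} → + M₂ ℤ∣.∣ x → + d ℤ.* m ℤ∣.∣ + κ ℤ.* x
      dm∣ {x} (ℤ∣.divides q x≡) = ℤ∣.divides q (begin
        + κ ℤ.* x                  ≡⟨ cong (λ u → + κ ℤ.* u) x≡ ⟩
        + κ ℤ.* (q ℤ.* + M₂)       ≡⟨ rearrange (+ κ) q (+ M₂) ⟩
        q ℤ.* (+ κ ℤ.* + M₂)       ≡⟨ cong (λ u → q ℤ.* u) dm≡ ⟨
        q ℤ.* (+ d ℤ.* m)          ∎)
        where
        open ≡-Reasoning
        rearrange : ∀ κ q m → κ ℤ.* (q ℤ.* m) ≡ q ℤ.* (κ ℤ.* m)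
        rearrange = solve-∀

    ·-coordinates : ∀ c q r →
      (∀ i → proj₁ (c MB.· (q , r)) i ≡ + c ℤ.* q i) × proj₂ (c MB.· (q , r)) ≡ + c ℤ.* r
    ·-coordinates zero    q r = (λ i → sym (ℤ.*-zeroˡ (q i))) , sym (ℤ.*-zeroˡ r)
    ·-coordinates (suc c) q r with ·-coordinates c q r
    ... | eq , er = (λ i → trans (cong (λ s → q i ℤ.+ s) (eq i)) (sym (ℤ.suc-* (+ c) (q i))))
                  , trans (cong (λ s → r ℤ.+ s) er) (sym (ℤ.suc-* (+ c) r))

    exponent : ∀ x → (p ^ (2 * a + b)) MB.· x B.≈ B.ε
    exponent (q , r) =
      (λ i → ∣⇒≈0 {M₁} (subst (+ M₁ ℤ∣.∣_) (sym (proj₁ (·-coordinates M₂ q r) i)) (ℤ∣.∣m⇒∣m*n (q i)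
        (ℤ∣.divides (+ (p ^ b)) (trans (cong +_ (trans (ℕ.^-distribˡ-+-* p (2 * a) b) (ℕ.*-comm M₁ (p ^ b))))
          (ℤ.pos-* (p ^ b) M₁)))))) ,
      ∣⇒≈0 {M₂} (subst (+ M₂ ℤ∣.∣_) (sym (proj₂ (·-coordinates M₂ q r))) (ℤ∣.∣m⇒∣m*n r ℤ∣.∣-refl))

    fromSlices : (V → Fin d → ℤ) → Fin (2 * n * d) → ℤ
    fromSlices y j = y (proj₁ (remQuot {2 * n} d j)) (proj₂ (remQuot {2 * n} d j))

    slice-fromSlices : ∀ y i g → slice (fromSlices y) i g ≡ y i g
    slice-fromSlices y i g = cong (λ (i , g) → y i g) (remQuot-combine {2 * n} {d} i g)

    everywhere : ∀ {x y : Fin (2 * n * d) → ℤ} → (∀ i g → x (i at g) ≡ y (i at g)) → ∀ j → x j ≡ y j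
    everywhere {x} {y} e j = subst (λ j → x j ≡ y j) (combine-remQuot {2 * n} d j)
      (e (proj₁ (remQuot {2 * n} d j)) (proj₂ (remQuot {2 * n} d j)))

    laplacian-fromSlices : ∀ z i g →
      (laplacian *ᵥ fromSlices z) (i at g) ≡ laplacianRow z i g
    laplacian-fromSlices z i g = trans (laplacian-at (fromSlices z) i g)
      (laplacianRow-cong (slice-fromSlices z) i g)

    φ : (Fin (2 * n * d) → ℤ) → B.Carrier
    φ x = coordinates (residual (slice x))

    φ-cong : ∀ {x y} → (∀ j → x j ≡ y j) → φ x B.≈ φ y
    φ-cong {x} {y} x≗y = coordinates-cong
      (residual-cong {slice x} {slice y} (λ i g → x≗y (i at g)))

    φ-homo : ∀ x y → φ (λ j → x j ℤ.+ y j) B.≈ φ x B.∙ φ y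
    φ-homo x y = B.trans {φ (λ j → x j ℤ.+ y j)} {coordinates (λ g → f g ℤ.+ f′ g)} {φ x B.∙ φ y}
      (coordinates-cong (residual-+ (slice x) (slice y))) (coordinates-+ f f′)
      where
      f f′ : Fin d → ℤ
      f = residual (slice x)
      f′ = residual (slice y)

    relations : ∀ z → φ (laplacian *ᵥ z) B.≈ B.ε
    relations z = coboundary⇒≈ε (residual (slice (laplacian *ᵥ z)))
      (coboundary (slice z v₂) (proj₁ row) λ g → trans
        (residual-cong {slice (laplacian *ᵥ z)} (laplacian-at z) g) (proj₂ row g))
      where
      row = residual-laplacianRow (slice z)

    kernel : ∀ x → ℤΣ.sum x ≡ 0ℤ → φ x B.≈ B.ε →
      ∃ λ z → ∀ j → + (n * n * n * κ) ℤ.* x j ≡ (laplacian *ᵥ z) j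
    kernel x Σx≡0 φx≈ε = fromSlices z , everywhere λ i g → begin
      + (n * n * n * κ) ℤ.* x (i at g)                  ≡⟨ cong (ℤ._* x (i at g)) product ⟩
      + n ℤ.* + n ℤ.* + n ℤ.* + κ ℤ.* x (i at g)        ≡⟨ proj₂ solution i g ⟩
      laplacianRow z i g                                ≡⟨ laplacian-fromSlices z i g ⟨
      (laplacian *ᵥ fromSlices z) (i at g)              ∎
      where
      open ≡-Reasoning
      open Coboundary (≈ε⇒coboundary (residual (slice x)) φx≈ε)
      solution = solvable (slice x) (+ κ) antidifference constant
        (trans (sym (sum-columnSum x)) Σx≡0) equation
      z = proj₁ solution
      product : + (n * n * n * κ) ≡ + n ℤ.* + n ℤ.* + n ℤ.* + κ
      product = trans (ℤ.pos-* (n * n * n) κ) (cong (ℤ._* + κ)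
        (trans (ℤ.pos-* (n * n) n) (cong (ℤ._* + n) (ℤ.pos-* n n))))

    image : ∀ b → ∃ λ x → ℤΣ.sum x ≡ 0ℤ × φ x B.≈ (n * n) MB.· b
    image (q , r) = fromSlices y ,
      trans (sum-columnSum (fromSlices y))
        (trans (ℤΣ.sum-cong-≗ (λ g → ℤΣ.sum-cong-≗ (λ i → slice-fromSlices y i g)))
          (columnSum-rotate⇒sum≡0 y f (divisorOf-rotate f))) ,
      (λ i → Z₁.reflexive (begin
        entries (residual (slice (fromSlices y))) i    ≡⟨ difference-affine {f′ = f} (+ (n * n)) (proj₁ residual-y) residual≡ (suc (suc i)) ⟩
        + (n * n) ℤ.* entries f i                      ≡⟨ cong (λ u → + (n * n) ℤ.* u) (entries-fromCoordinates q r i) ⟩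
        + (n * n) ℤ.* q i                              ≡⟨ proj₁ (·-coordinates (n * n) q r) i ⟨
        proj₁ ((n * n) MB.· (q , r)) i                 ∎)) ,
      Z₂.reflexive (begin
        total (residual (slice (fromSlices y)))        ≡⟨ total-affine {f′ = f} (+ (n * n)) (proj₁ residual-y) residual≡ ⟩
        + (n * n) ℤ.* total f                          ≡⟨ cong (λ u → + (n * n) ℤ.* u) (total-fromCoordinates q r) ⟩
        + (n * n) ℤ.* r                                ≡⟨ proj₂ (·-coordinates (n * n) q r) ⟨
        proj₂ ((n * n) MB.· (q , r))                   ∎)
      where
      open ≡-Reasoning
      f : Fin d → ℤ
      f = fromCoordinates q r
      y : V → Fin d → ℤ
      y = divisorOf f
      residual-y = residual-divisorOf f
      residual≡ : ∀ g → residual (slice (fromSlices y)) g ≡ + (n * n) ℤ.* f g ℤ.+ proj₁ residual-y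
      residual≡ g = trans (residual-cong {slice (fromSlices y)} (slice-fromSlices y) g)
        (trans (proj₂ residual-y g) (cong (λ u → u ℤ.* f g ℤ.+ proj₁ residual-y) (sym (ℤ.pos-* n n))))

  -- The unreduced suc (suc k) ∸ 2 keeps this type syntactically equal to the one in theorem8:
  -- comparing the two groups by unfolding them exhausts the memory.
  sylow-jacobian : ∀ v →
    Sylow p (Graph.jacobian (singleVoltageCover (suc (suc n′)) (suc (suc k))) v) ≅
    (ℤ/ (p ^ (2 * a))) ^⊕ (suc (suc k) ∸ 2) ⊕ (ℤ/ (p ^ (2 * a + b)))
  sylow-jacobian v = sylow-graph-jacobian (singleVoltageCover (suc (suc n′)) (suc (suc k))) v sum-laplacian
    ((ℤ/ (p ^ (2 * a))) ^⊕ (suc (suc k) ∸ 2) ⊕ (ℤ/ (p ^ (2 * a + b))))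
    {p} {2 * a + b} {n * n * n * κ} {n * n} p-prime
    (∤-* p-prime (∤-* p-prime p∤n² p∤n) (∤-* p-prime (∤-* p-prime p∤α p∤α) p∤β)) p∤n²
    φ (λ {x} {y} → φ-cong {x} {y}) φ-homo relations kernel image exponent
    where
    p∤n² : p ∤ n * n
    p∤n² = ∤-* p-prime p∤n p∤n

-- Number of generators and order of the Sylow subgroup

module _ {p} (p-prime : Prime p) {M₁ M₂ k : ℕ} where
  private
    B = (ℤ/ M₁) ^⊕ k ⊕ (ℤ/ M₂)
    module B = AbelianGroup B
    module Z = AbelianGroup (ℤ/ p)
    module C = AbelianGroup ((ℤ/ p) ^⊕ suc k)

    components : B.Carrier → C.Carrier
    components (q , r) zero    = r
    components (q , r) (suc i) = q i

  -- The standard basis gives the upper bound. As p divides both moduli, reduction modulo p maps the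
  -- group onto (ℤ/p)^(k + 1), which gives the lower bound.
  ≅-minimalNumberOfGenerators : ∀ {A} → p ∣ M₁ → p ∣ M₂ → A ≅ B → MinimalNumberOfGenerators A (suc k)
  ≅-minimalNumberOfGenerators {A} p∣M₁ p∣M₂ A≅B@(φ , iso) =
    (_ , ≅-generates {A} {B} A≅B (standardBasis-generates M₁ M₂ k)) ,
    elementary-quotient⇒rank≥ p-prime A {suc k}
      (λ x → components (φ x)) (λ {x} {y} x≈y → reduce (φ x) (φ y) (I.⟦⟧-cong x≈y))
      (λ x y → C.trans {components (φ (x A.∙ y))} {components (φ x B.∙ φ y)} {components (φ x) C.∙ components (φ y)}
        (reduce (φ (x A.∙ y)) (φ x B.∙ φ y) (I.∙-homo x y))
        (λ { zero → Z.refl {components (φ x B.∙ φ y) zero} ; (suc i) → Z.refl {components (φ x B.∙ φ y) (suc i)} }))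
      (λ c → let b = (c ∘ suc) , c zero ; x , φx≈b = I.surjective b in
        x , C.trans {components (φ x)} {components b} {c} (reduce (φ x) b (φx≈b A.refl))
          (λ { zero → Z.refl {c zero} ; (suc i) → Z.refl {c (suc i)} }))
    where
    module A = AbelianGroup A
    module I = GroupMorphisms.IsGroupIsomorphism iso
    reduce : ∀ b b′ → b B.≈ b′ → components b C.≈ components b′
    reduce b b′ (q≈ , r≈) zero    = ℤ∣.∣-trans (ℤ∣.∣ᵤ⇒∣ p∣M₂) r≈
    reduce b b′ (q≈ , r≈) (suc i) = ℤ∣.∣-trans (ℤ∣.∣ᵤ⇒∣ p∣M₁) (q≈ i)

order-exponent : ∀ p a b k → (p ^ (2 * a)) ^ k * p ^ (2 * a + b) ≡ p ^ (2 * a * suc k + b)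
order-exponent p a b k = begin
  (p ^ (2 * a)) ^ k * p ^ (2 * a + b)  ≡⟨ cong (_* p ^ (2 * a + b)) (ℕ.^-*-assoc p (2 * a) k) ⟩
  p ^ (2 * a * k) * p ^ (2 * a + b)    ≡⟨ ℕ.^-distribˡ-+-* p (2 * a * k) (2 * a + b) ⟨
  p ^ (2 * a * k + (2 * a + b))        ≡⟨ cong (p ^_) (ℕ.+-assoc (2 * a * k) (2 * a) b) ⟨
  p ^ (2 * a * k + 2 * a + b)          ≡⟨ cong (λ u → p ^ (u + b)) (trans (ℕ.+-comm (2 * a * k) (2 * a)) (sym (ℕ.*-suc (2 * a) k))) ⟩
  p ^ (2 * a * suc k + b)              ∎
  where open ≡-Reasoning

sylow-structure : ∀ (A : Ab) p a b m d → 2 ≤ d → Prime p → IsLargestPower p a m →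
  Sylow p A ≅ (ℤ/ (p ^ (2 * a))) ^⊕ (d ∸ 2) ⊕ (ℤ/ (p ^ (2 * a + b))) →
  (Sylow p A ≅ (ℤ/ (p ^ (2 * a))) ^⊕ (d ∸ 2) ⊕ (ℤ/ (p ^ (2 * a + b))))
  × HasOrder (Sylow p A) (p ^ (2 * a * (d ∸ 1) + b))
  × (p ∣ m → PRank p A (d ∸ 1))
sylow-structure A p a b m (suc (suc k)) (s≤s (s≤s _)) p-prime a-largest iso = iso , order , rank
  where
  S = Sylow p A
  instance
    p≢0 : NonZero p
    p≢0 = prime⇒nonZero p-prime

  order : HasOrder S (p ^ (2 * a * suc k + b))
  order = subst (HasOrder S) (order-exponent p a b k) (≅-hasOrder {S} {(ℤ/ (p ^ (2 * a))) ^⊕ k ⊕ (ℤ/ (p ^ (2 * a + b)))} iso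
    (hasOrder-⊕ {(ℤ/ (p ^ (2 * a))) ^⊕ k} {ℤ/ (p ^ (2 * a + b))}
      (hasOrder-^⊕ {ℤ/ (p ^ (2 * a))} k (hasOrder-ℤ/ (p ^ (2 * a)) {{ℕ.m^n≢0 p (2 * a)}}))
      (hasOrder-ℤ/ (p ^ (2 * a + b)) {{ℕ.m^n≢0 p (2 * a + b)}})))

  p∣p^2a : ∀ {a} → 1 ≤ a → p ∣ p ^ (2 * a)
  p∣p^2a {suc a} _ = m∣m*n (p ^ (a + suc (a + 0)))

  -- The condition on p means a ≥ 1. For a = 0 the summands ℤ/p^(2a) are trivial and the group is
  -- cyclic of order p^b.
  rank : p ∣ m → MinimalNumberOfGenerators S (suc k)
  rank p∣m = ≅-minimalNumberOfGenerators p-prime {p ^ (2 * a)} {p ^ (2 * a + b)} {k} {S} p∣M₁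
    (subst (p ∣_) (sym (ℕ.^-distribˡ-+-* p (2 * a) b)) (∣-trans p∣M₁ (m∣m*n (p ^ b)))) iso
    where
    p∣M₁ : p ∣ p ^ (2 * a)
    -- Maximality of a, tested at the exponent 1, gives 1 ≤ a.
    p∣M₁ = p∣p^2a (proj₂ a-largest 1 (subst (_∣ m) (sym (ℕ.*-identityʳ p)) p∣m))

theorem8 : ∀ (n d : ℕ) → 3 ≤ n → 3 ≤ d →
    ∀ (p : ℕ) → Prime p → p ∤ n →
    ∀ (a b : ℕ) → IsLargestPower p a (n ∸ 1) → IsLargestPower p b d →
    let Y = singleVoltageCover n d in
    ∀ (v : Graph.Vertex Y) →
    let J = Graph.jacobian Y v in
    (Sylow p J ≅ (ℤ/ (p ^ (2 * a))) ^⊕ (d ∸ 2) ⊕ (ℤ/ (p ^ (2 * a + b))))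
    × HasOrder (Sylow p J) (p ^ (2 * a * (d ∸ 1) + b))
    × (p ∣ n ∸ 1 → PRank p J (d ∸ 1))
theorem8 (suc (suc n′)) (suc (suc k)) (s≤s (s≤s _)) (s≤s (s≤s _)) p p-prime p∤n a b a-largest b-largest v =
  sylow-structure (Graph.jacobian (singleVoltageCover (suc (suc n′)) (suc (suc k))) v)
    p a b (suc (suc n′) ∸ 1) (suc (suc k)) (s≤s (s≤s ℕ.z≤n)) p-prime a-largest
    (sylow-jacobian n′ k p a b p-prime p∤n a-largest b-largest v)
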